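{- Fix integers $2\le r\le k$. There is a constant $c=c(k,r)>0$ such that every $k$-uniform hypergraph $H$ on $n$ vertices with no isolated vertices has an $r$-cut with excess at least $cn$. In particular, if $k>2$, then every such $H$ has a $2$-cut with excess at least $n/(k2^{k-1})$; this is best possible, since for a $k$-uniform perfect matching on $n$ vertices the maximum excess of a $2$-cut equals $n/(k2^{k-1})$.
   Context: For $2\le r\le k$, an $r$-cut of a $k$-uniform hypergraph $H$ is a partition of $V(H)$ into $r$ labelled parts; its size is the number of edges having a vertex in every part. The excess of an $r$-cut of an $m$-edge $k$-uniform hypergraph is its size minus $\frac{S(k,r)r!}{r^k}m$, where $S(k,r)$ is the Stirling number of the second kind (for $r=2$ this is $(1-2^{1-k})m$). A vertex is isolated if it lies in no edge. A $k$-uniform perfect matching is a $k$-uniform hypergraph in which every vertex lies in exactly one edge. -}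

module Defs where

open import Data.Nat using (ℕ; zero; suc; _+_; _*_; _^_; _!)
open import Data.Nat.Properties using (m^n≢0; m*n≢0)

open import Data.Integer using (+_)
open import Data.Rational using (ℚ; _/_; _-_; 0ℚ) renaming (_*_ to _*ℚ_)
open import Data.Fin using (Fin)
open import Data.Fin.Properties using (any?; all?)
open import Data.Fin.Subset using (Subset; _∈_; ∣_∣)
open import Data.Fin.Subset.Properties using (_∈?_)
open import Data.List using (List; length; filter)
open import Data.List.Relation.Unary.All using (All)
open import Data.List.Relation.Unary.Any using (Any)
open import Data.List.Relation.Unary.Unique.Propositional using (Unique)
open import Data.Product using (Σ; ∃; ∃-syntax; _×_; _,_)
open import Relation.Binary.PropositionalEquality using (_≡_)
open import Relation.Nullary using (Dec)
open import Relation.Nullary.Decidable using (_×-dec_)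
import Data.Fin.Properties as FinP

stirling2 : ℕ → ℕ → ℕ
stirling2 zero    zero    = 1
stirling2 zero    (suc r) = 0
stirling2 (suc k) zero    = 0
stirling2 (suc k) (suc r) = suc r * stirling2 k (suc r) + stirling2 k r

ℕ→ℚ : ℕ → ℚ
ℕ→ℚ n = + n / 1

-- the density S(k,r) r! / r^k  (only used for r ≥ 2; the r = 0 case is a dummy value)
density : (k r : ℕ) → ℚ
density k zero    = 0ℚ
density k (suc r) = _/_ (+ (stirling2 k (suc r) * (suc r) !)) (suc r ^ k) {{m^n≢0 (suc r) k}}

record Hypergraph (k n : ℕ) : Set where
  field
    edges    : List (Subset n)
    uniform  : All (λ e → ∣ e ∣ ≡ k) edges
    distinct : Unique edges
open Hypergraph public

numEdges : ∀ {k n} → Hypergraph k n → ℕ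
numEdges H = length (edges H)

NoIsolatedVertices : ∀ {k n} → Hypergraph k n → Set
NoIsolatedVertices {n = n} H = (v : Fin n) → Any (v ∈_) (edges H)

IsPerfectMatching : ∀ {k n} → Hypergraph k n → Set
IsPerfectMatching {n = n} H = (v : Fin n) → length (filter (v ∈?_) (edges H)) ≡ 1

Cut : (n r : ℕ) → Set
Cut n r = Fin n → Fin r

IsCutEdge : ∀ {n r} → Cut n r → Subset n → Set
IsCutEdge {n} {r} f e = (j : Fin r) → ∃[ v ] (v ∈ e × f v ≡ j)

isCutEdge? : ∀ {n r} (f : Cut n r) (e : Subset n) → Dec (IsCutEdge f e)
isCutEdge? f e = all? (λ j → any? (λ v → (v ∈? e) ×-dec (f v FinP.≟ j)))

cutSize : ∀ {k n r} → Hypergraph k n → Cut n r → ℕ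
cutSize H f = length (filter (isCutEdge? f) (edges H))

excess : ∀ {k n r} → Hypergraph k n → Cut n r → ℚ
excess {k} {n} {r} H f = ℕ→ℚ (cutSize H f) - density k r *ℚ ℕ→ℚ (numEdges H)

-- n / (k 2^(k-1))  (only used for k ≥ 3; k = 0 is a dummy value)
matchingBound : (k n : ℕ) → ℚ
matchingBound zero    n = 0ℚ
matchingBound (suc k) n = _/_ (+ n) (suc k * 2 ^ k) {{m*n≢0 (suc k) (2 ^ k) {{_}} {{m^n≢0 2 k}}}}

{-# OPTIONS --safe #-}

-- Let S be a star forest of links (leaf, centre), each contained in an edge of H, these edges being
-- distinct, such that no edge of H contains two leaves of the same star.  Colour the vertices
-- uniformly at random conditioned on every leaf differing from its centre.  The links inside an
-- edge e are then disjoint, and leaves whose centre lies outside e are uniform and independent of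
-- the rest of e.  Making the two ends of a link inside e equal instead of different can only
-- destroy a cut, so e is cut with probability at least S(k,r) r! / r^k, and conditioning on a
-- link inside e gains at least S(k-1,r-1) (r-2)! / r^(k-1), which is 2^(1-k) for r = 2.  Hence some
-- cut has excess at least |S| times this gain.
--
-- A star forest with n ≤ max(k, 3) |S| is grown as follows.  Starting from C = ∅, add to C edges
-- with at least two vertices outside C as long as there are any.  Every vertex left outside C
-- becomes a leaf of a vertex of C sharing an edge with it.  Going back through the added edges,
-- link two vertices that the edge had newly added to C whenever two of them are not centres.

module Submission where

open import Defs
open import Data.Nat using (ℕ; _≤_; _<_)
open import Data.Rational using (ℚ; 0ℚ) renaming (_≤_ to _≤ℚ_; _<_ to _<ℚ_; _*_ to _*ℚ_)
open import Data.Product using (Σ; ∃; ∃-syntax; _×_; _,_)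
open import Relation.Binary.PropositionalEquality using (_≡_)

import Algebra.Properties.CommutativeSemigroup
import Algebra.Properties.Semiring.Sum
import Data.Bool.Properties as Bool
open import Data.Empty using (⊥-elim)
open import Data.Fin using (Fin; zero; suc)
import Data.Fin.Properties as Fin
open import Data.Fin.Subset using (Subset; inside; outside; _∈_; _∉_; ∣_∣; _∩_; _∪_; ∁; ⊤; ⊥)
open import Data.Fin.Subset.Properties using (_∈?_; ∣p∣≤n; ∣⊤∣≡n; ∣⊥∣≡0; ∈⊤; ∉⊥; ∣p∣≡n⇒p≡⊤; p⊆q⇒∣p∣≤∣q∣; nonempty?; Empty-unique; ∣p∩q∣≤∣p∣; ∣p∩q∣≤∣q∣; x∈∁p⇒x∉p; x∉p⇒x∈∁p; p⊆p∪q; q⊆p∪q; ∩-comm; x∈p∩q⁺; x∈p∩q⁻; ∣∁p∣≡n∸∣p∣; drop-there)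
import Data.Integer as ℤ
import Data.Integer.Properties as ℤ
open import Data.List using (List; []; _∷_; length; filter; map)
open import Data.List.Properties using (length-map; length-filter)
open import Data.List.Membership.Propositional using (find; lose) renaming (_∈_ to _∈ˡ_)
open import Data.List.Membership.Propositional.Properties using (∈-filter⁺; ∈-filter⁻; ∈-map⁻)
open import Data.List.Relation.Unary.Any using (Any; here; there; any?)
open import Data.List.Relation.Unary.All as All using (All; []; _∷_)
import Data.List.Relation.Unary.All.Properties as All
open import Data.List.Relation.Unary.AllPairs using (AllPairs; []; _∷_)
import Data.List.Relation.Unary.AllPairs.Properties as AllPairs
import Data.List.Relation.Unary.Unique.Propositional.Properties as Unique
open import Data.Nat using (zero; suc; pred; _+_; _*_; _∸_; _^_; _!; _⊔_; z≤n; s≤s; s≤s⁻¹; _≤?_; NonZero; >-nonZero; >-nonZero⁻¹)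
open import Data.Nat.Induction using (Acc; acc; <-wellFounded)
open import Data.Nat.ListAction using () renaming (sum to ℕ-sum)
open import Data.Nat.Properties
open import Data.Nat.Tactic.RingSolver using (solve-∀)
open import Data.Product using (proj₁; proj₂)
open import Data.Rational as ℚ using (_/_; toℚᵘ)
open import Data.Rational.Properties as ℚ using (toℚᵘ-fromℚᵘ; toℚᵘ-homo-*; toℚᵘ-homo-+; toℚᵘ-cancel-≤)
open import Data.Rational.Unnormalised as ℚᵘ using (mkℚᵘ)
import Data.Rational.Unnormalised.Properties as ℚᵘ
open import Data.Sum using (_⊎_; inj₁; inj₂; [_,_]′)
open import Data.Vec using (Vec; []; _∷_; here; there; lookup; _[_]≔_)
open import Data.Vec.Properties using (≡-dec; lookup∘update; lookup∘update′; []≔-updates; []≔-minimal; []=-injective; lookup⇒[]=; []=⇒lookup)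
open import Function using (_∘_; id)
open import Relation.Binary.PropositionalEquality using (_≢_; refl; sym; trans; cong; cong₂; subst; subst₂; ≢-sym; module ≡-Reasoning)
import Relation.Binary.Reasoning.Setoid as ≈-Reasoning
open import Relation.Nullary using (Dec; yes; no; contradiction; ¬?)
open import Relation.Nullary.Decidable using (_×-dec_; _⊎-dec_; map′; decidable-stable)

private
  module ∑ = Algebra.Properties.Semiring.Sum +-*-semiring
  module * = Algebra.Properties.CommutativeSemigroup *-commutativeSemigroup
open ∑ using (sum)

private variable
  n r q : ℕ

-- Finite sums of natural numbers

sum-mono : {f g : Fin n → ℕ} → (∀ i → f i ≤ g i) → sum f ≤ sum g
sum-mono {zero}  f≤g = z≤n
sum-mono {suc n} f≤g = +-mono-≤ (f≤g zero) (sum-mono (f≤g ∘ suc))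

sum-const : ∀ n {k} → sum {n} (λ _ → k) ≡ n * k
sum-const zero    = refl
sum-const (suc n) = cong (_ +_) (sum-const n)

-- Sums over all colourings

-- Colourings are vectors and not functions of type `Cut n r`, so that sums recurse on the vertices
-- and recolouring one vertex is a vector update. Expectations are such sums with all denominators
-- multiplied out.
∑ᶜ : (Vec (Fin r) n → ℕ) → ℕ
∑ᶜ {n = zero}  F = F []
∑ᶜ {n = suc n} F = sum λ c → ∑ᶜ λ x → F (c ∷ x)

∑ᶜ-cong : {F G : Vec (Fin r) n → ℕ} → (∀ x → F x ≡ G x) → ∑ᶜ F ≡ ∑ᶜ G
∑ᶜ-cong {n = zero}  eq = eq []
∑ᶜ-cong {n = suc n} eq = ∑.sum-cong-≗ λ c → ∑ᶜ-cong λ x → eq (c ∷ x)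

∑ᶜ-mono : {F G : Vec (Fin r) n → ℕ} → (∀ x → F x ≤ G x) → ∑ᶜ F ≤ ∑ᶜ G
∑ᶜ-mono {n = zero}  F≤G = F≤G []
∑ᶜ-mono {n = suc n} F≤G = sum-mono λ c → ∑ᶜ-mono λ x → F≤G (c ∷ x)

∑ᶜ-distrib-+ : (F G : Vec (Fin r) n → ℕ) → ∑ᶜ (λ x → F x + G x) ≡ ∑ᶜ F + ∑ᶜ G
∑ᶜ-distrib-+ {n = zero}  F G = refl
∑ᶜ-distrib-+ {n = suc n} F G =
  trans (∑.sum-cong-≗ λ c → ∑ᶜ-distrib-+ (F ∘ (c ∷_)) (G ∘ (c ∷_))) (∑.∑-distrib-+ (λ c → ∑ᶜ (F ∘ (c ∷_))) (λ c → ∑ᶜ (G ∘ (c ∷_))))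

*-distribˡ-∑ᶜ : ∀ k (F : Vec (Fin r) n → ℕ) → k * ∑ᶜ F ≡ ∑ᶜ (λ x → k * F x)
*-distribˡ-∑ᶜ {n = zero}  k F = refl
*-distribˡ-∑ᶜ {n = suc n} k F =
  trans (∑.*-distribˡ-sum k (λ c → ∑ᶜ (F ∘ (c ∷_)))) (∑.sum-cong-≗ λ c → *-distribˡ-∑ᶜ k (F ∘ (c ∷_)))

∑ᶜ-const : ∀ k → ∑ᶜ {r} {n} (λ _ → k) ≡ r ^ n * k
∑ᶜ-const {n = zero} k = sym (+-identityʳ k)
∑ᶜ-const {r} {suc n} k = begin
  sum {r} (λ _ → ∑ᶜ {r} {n} (λ _ → k)) ≡⟨ sum-const r ⟩
  r * ∑ᶜ {r} {n} (λ _ → k)             ≡⟨ cong (r *_) (∑ᶜ-const {r} {n} k) ⟩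
  r * (r ^ n * k)                      ≡⟨ *-assoc r (r ^ n) k ⟨
  r * r ^ n * k                        ∎
  where open ≡-Reasoning

∑ᶜ-sum-comm : ∀ {m} (F : Vec (Fin r) n → Fin m → ℕ) →
              ∑ᶜ (λ x → sum (F x)) ≡ sum (λ i → ∑ᶜ (λ x → F x i))
∑ᶜ-sum-comm {n = zero}  F = refl
∑ᶜ-sum-comm {n = suc n} F =
  trans (∑.sum-cong-≗ λ c → ∑ᶜ-sum-comm (F ∘ (c ∷_))) (∑.∑-comm λ c i → ∑ᶜ λ x → F (c ∷ x) i)

-- Every colouring arises as `x [ a ]≔ c` from exactly `r` pairs `(x , c)`, because the colour of
-- `x` at `a` is forgotten. This expresses that the colour of `a` may be drawn last.
resample : ∀ (a : Fin n) (F : Vec (Fin r) n → ℕ) →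
           r * ∑ᶜ F ≡ ∑ᶜ (λ x → sum λ c → F (x [ a ]≔ c))
resample {r = r} zero F = begin
  r * sum (λ c → ∑ᶜ λ x → F (c ∷ x))              ≡⟨ cong (r *_) (∑ᶜ-sum-comm (λ x c → F (c ∷ x))) ⟨
  r * ∑ᶜ (λ x → sum λ c → F (c ∷ x))              ≡⟨ sum-const r ⟨
  sum {r} (λ _ → ∑ᶜ (λ x → sum λ c → F (c ∷ x)))  ∎
  where open ≡-Reasoning
resample {r = r} (suc a) F =
  trans (∑.*-distribˡ-sum r (λ c → ∑ᶜ (F ∘ (c ∷_)))) (∑.sum-cong-≗ λ c → resample a (F ∘ (c ∷_)))

∃-colouring? : {P : Vec (Fin r) n → Set} → (∀ x → Dec (P x)) → Dec (∃ P)
∃-colouring? {n = zero}  P? = map′ (λ p → [] , p) (λ { ([] , p) → p }) (P? [])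
∃-colouring? {n = suc n} P? =
  map′ (λ { (c , x , p) → c ∷ x , p }) (λ { (c ∷ x , p) → c , x , p })
       (Fin.any? λ c → ∃-colouring? (P? ∘ (c ∷_)))

-- If `F x < B` for every `x`, then `w x + w x * F x ≤ B * w x`. Summing contradicts the hypotheses,
-- as the total weight is positive. A colouring is found by exhaustive search.
averaging : (w F : Vec (Fin r) n → ℕ) (B : ℕ) → 0 < ∑ᶜ w →
            B * ∑ᶜ w ≤ ∑ᶜ (λ x → w x * F x) → ∃[ x ] B ≤ F x
averaging w F B w>0 avg with ∃-colouring? (λ x → B ≤? F x)
... | yes p = p
... | no ¬p = contradiction (≤-trans (+-mono-≤ w>0 avg) (≤-trans (≤-reflexive (sym (∑ᶜ-distrib-+ w _))) below)) (<-irrefl refl)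
  where
  below : ∑ᶜ (λ x → w x + w x * F x) ≤ B * ∑ᶜ w
  below = begin
    ∑ᶜ (λ x → w x + w x * F x) ≤⟨ ∑ᶜ-mono (λ x → ≤-trans (≤-reflexive (sym (*-suc (w x) (F x))))
                                               (≤-trans (*-monoʳ-≤ (w x) (≰⇒> λ B≤ → ¬p (x , B≤)))
                                                        (≤-reflexive (*-comm (w x) B)))) ⟩
    ∑ᶜ (λ x → B * w x)         ≡⟨ *-distribˡ-∑ᶜ B w ⟨
    B * ∑ᶜ w                   ∎
    where open ≤-Reasoning

-- The number of surjections

-- The number of words of length t over a + M letters that use M given letters.
covering : (t a M : ℕ) → ℕ
covering zero    a zero    = 1
covering zero    a (suc M) = 0
covering (suc t) a M       = a * covering t a M + M * covering t (suc a) (pred M)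

-- A word meeting M given letters either meets or avoids one further given letter.
covering-suc : ∀ t a M → covering t (suc a) M ≡ covering t a (suc M) + covering t a M
covering-suc zero    a zero    = refl
covering-suc zero    a (suc M) = refl
covering-suc (suc t) a zero    = begin
  (suc a * X + 0)                      ≡⟨ lem₁ a X ⟩
  (a * X + X)                          ≡⟨ cong (λ z → a * z + X) (covering-suc t a 0) ⟩
  (a * (Y + Z) + X)                    ≡⟨ lem₂ a X Y Z ⟩
  a * Y + (X + 0) + (a * Z + 0)        ∎
  where
  open ≡-Reasoning
  X = covering t (suc a) 0
  Y = covering t a 1
  Z = covering t a 0
  lem₁ : ∀ a X → suc a * X + 0 ≡ a * X + X
  lem₁ = solve-∀
  lem₂ : ∀ a X Y Z → a * (Y + Z) + X ≡ a * Y + (X + 0) + (a * Z + 0)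
  lem₂ = solve-∀
covering-suc (suc t) a (suc M) = begin
  suc a * X + suc M * covering t (2 + a) M      ≡⟨ cong (λ z → suc a * X + suc M * z) (covering-suc t (suc a) M) ⟩
  suc a * X + suc M * (X + W)                   ≡⟨ lem₁ a M X W ⟩
  a * X + ((2 + M) * X + suc M * W)             ≡⟨ cong (λ z → a * z + ((2 + M) * X + suc M * W)) (covering-suc t a (suc M)) ⟩
  a * (Y + Z) + ((2 + M) * X + suc M * W)       ≡⟨ lem₂ a M X Y Z W ⟩
  a * Y + (2 + M) * X + (a * Z + suc M * W)     ∎
  where
  open ≡-Reasoning
  X = covering t (suc a) (suc M)
  W = covering t (suc a) M
  Y = covering t a (2 + M)
  Z = covering t a (suc M)
  lem₁ : ∀ a M X W → suc a * X + suc M * (X + W) ≡ a * X + ((2 + M) * X + suc M * W)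
  lem₁ = solve-∀
  lem₂ : ∀ a M X Y Z W → a * (Y + Z) + ((2 + M) * X + suc M * W) ≡ a * Y + (2 + M) * X + (a * Z + suc M * W)
  lem₂ = solve-∀

surjections : (k r : ℕ) → ℕ
surjections k r = stirling2 k r * r !

-- Choose the colour of one element; the others either use all colours or all except that one.
surjections-suc : ∀ k r → surjections (suc k) (suc r) ≡ suc r * (surjections k (suc r) + surjections k r)
surjections-suc k r = lem r (stirling2 k (suc r)) (stirling2 k r) (r !)
  where
  lem : ∀ r a b f → (suc r * a + b) * (suc r * f) ≡ suc r * (a * (suc r * f) + b * f)
  lem = solve-∀

-- With no free letters, every letter has to be used. By `covering-suc` both sides satisfy the
-- recurrence `surjections-suc`.
covering-surjections : ∀ k r → covering k 0 r ≡ surjections k r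
covering-surjections zero    zero    = refl
covering-surjections zero    (suc r) = refl
covering-surjections (suc k) zero    = refl
covering-surjections (suc k) (suc r) = begin
  suc r * covering k 1 r                            ≡⟨ cong (suc r *_) (covering-suc k 0 r) ⟩
  suc r * (covering k 0 (suc r) + covering k 0 r)   ≡⟨ cong₂ (λ a b → suc r * (a + b)) (covering-surjections k (suc r)) (covering-surjections k r) ⟩
  suc r * (surjections k (suc r) + surjections k r) ≡⟨ surjections-suc k r ⟨
  surjections (suc k) (suc r)                       ∎
  where open ≡-Reasoning

stirling2-pos : ∀ {k r} → r ≤ k → 0 < stirling2 (suc k) (suc r)
stirling2-pos {zero}  {zero}  _ = s≤s z≤n
stirling2-pos {suc k} {zero}  _ = ≤-trans (stirling2-pos {k} {zero} z≤n)
                                   (≤-trans (m≤m+n _ _) (m≤m+n _ _))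
stirling2-pos {suc k} {suc r} (s≤s r≤k) =
  ≤-trans (stirling2-pos r≤k) (m≤n+m _ ((2 + r) * stirling2 (suc k) (2 + r)))

-- Counting the colourings that cut a given edge

𝟙 : ∀ {P : Set} → Dec P → ℕ
𝟙 (yes _) = 1
𝟙 (no  _) = 0

𝟙-mono : ∀ {P Q : Set} (p : Dec P) (q : Dec Q) → (P → Q) → 𝟙 p ≤ 𝟙 q
𝟙-mono (yes p) (yes q) f = s≤s z≤n
𝟙-mono (yes p) (no ¬q) f = contradiction (f p) ¬q
𝟙-mono (no ¬p) _       f = z≤n

𝟙-cong : ∀ {P Q : Set} (p : Dec P) (q : Dec Q) → (P → Q) → (Q → P) → 𝟙 p ≡ 𝟙 q
𝟙-cong p q f g = ≤-antisym (𝟙-mono p q f) (𝟙-mono q p g)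

insert : Subset r → Fin r → Subset r
insert C c = C [ c ]≔ inside

∈-insert : ∀ (C : Subset r) c → c ∈ insert C c
∈-insert C c = []≔-updates C c

∈-insert⁺ : ∀ (C : Subset r) c {j} → j ∈ C → j ∈ insert C c
∈-insert⁺ C c {j} j∈C with j Fin.≟ c
... | yes refl = ∈-insert C c
... | no  j≢c  = []≔-minimal C j c j≢c j∈C

∈-insert⁻ : ∀ (C : Subset r) c {j} → j ∈ insert C c → j ≡ c ⊎ j ∈ C
∈-insert⁻ C c {j} j∈ with j Fin.≟ c
... | yes j≡c = inj₁ j≡c
... | no  j≢c = inj₂ (lookup⇒[]= j C (trans (sym (lookup∘update′ j≢c C inside)) ([]=⇒lookup j∈)))

sum-insert : ∀ (C : Subset r) (h : ℕ → ℕ) →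
             sum (λ c → h ∣ insert C c ∣) ≡ ∣ C ∣ * h ∣ C ∣ + (r ∸ ∣ C ∣) * h (suc ∣ C ∣)
sum-insert [] h = refl
sum-insert {suc r} (inside ∷ C) h = trans (cong (h (suc ∣ C ∣) +_) (sum-insert C (h ∘ suc)))
                                          (sym (+-assoc (h (suc ∣ C ∣)) _ _))
sum-insert {suc r} (outside ∷ C) h = begin
  Y + sum (λ c → h ∣ insert C c ∣)      ≡⟨ cong (Y +_) (sum-insert C h) ⟩
  Y + (∣ C ∣ * X + (r ∸ ∣ C ∣) * Y)     ≡⟨ lem (∣ C ∣ * X) Y (r ∸ ∣ C ∣) ⟩
  ∣ C ∣ * X + suc (r ∸ ∣ C ∣) * Y       ≡⟨ cong (λ z → ∣ C ∣ * X + z * Y) (+-∸-assoc 1 (∣p∣≤n C)) ⟨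
  ∣ C ∣ * X + (suc r ∸ ∣ C ∣) * Y       ∎
  where
  open ≡-Reasoning
  X = h ∣ C ∣
  Y = h (suc ∣ C ∣)
  lem : ∀ a Y m → Y + (a + m * Y) ≡ a + suc m * Y
  lem = solve-∀

-- The set `C` holds the colours already seen, so that the vertices of `e` can be processed one at a
-- time; cut edges are the case `C = ⊥`.
Covers : Subset r → Subset n → Vec (Fin r) n → Set
Covers {r} {n} C e x = (j : Fin r) → j ∈ C ⊎ ∃[ v ] (v ∈ e × lookup x v ≡ j)

covers? : (C : Subset r) (e : Subset n) (x : Vec (Fin r) n) → Dec (Covers C e x)
covers? C e x = Fin.all? λ j → (j ∈? C) ⊎-dec Fin.any? λ v → (v ∈? e) ×-dec (lookup x v Fin.≟ j)

covers-outside⁺ : ∀ {C : Subset r} {e : Subset n} {x c} → Covers C e x → Covers C (outside ∷ e) (c ∷ x)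
covers-outside⁺ cov j with cov j
... | inj₁ j∈C              = inj₁ j∈C
... | inj₂ (v , v∈e , xv≡j) = inj₂ (suc v , there v∈e , xv≡j)

covers-outside⁻ : ∀ {C : Subset r} {e : Subset n} {x c} → Covers C (outside ∷ e) (c ∷ x) → Covers C e x
covers-outside⁻ cov j with cov j
... | inj₁ j∈C                                 = inj₁ j∈C
... | inj₂ (suc v , there v∈e , xv≡j) = inj₂ (v , v∈e , xv≡j)

covers-inside⁺ : ∀ {C : Subset r} {e : Subset n} {x c} → Covers (insert C c) e x → Covers C (inside ∷ e) (c ∷ x)
covers-inside⁺ {C = C} {c = c} cov j with cov j
... | inj₂ (v , v∈e , xv≡j) = inj₂ (suc v , there v∈e , xv≡j)
... | inj₁ j∈ with ∈-insert⁻ C c j∈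
...   | inj₁ j≡c = inj₂ (zero , here , sym j≡c)
...   | inj₂ j∈C = inj₁ j∈C

covers-inside⁻ : ∀ {C : Subset r} {e : Subset n} {x c} → Covers C (inside ∷ e) (c ∷ x) → Covers (insert C c) e x
covers-inside⁻ {C = C} {c = c} cov j with cov j
... | inj₁ j∈C                                 = inj₁ (∈-insert⁺ C c j∈C)
... | inj₂ (zero , _ , refl)                   = inj₁ (∈-insert C c)
... | inj₂ (suc v , there v∈e , xv≡j) = inj₂ (v , v∈e , xv≡j)

-- Induction on the vertices: one outside `e` has a free colour and contributes a factor `r`, while
-- one inside `e` adds its colour to `C`. By `sum-insert` the latter is the recursion defining
-- `covering`.
count-covers : ∀ (C : Subset r) (e : Subset n) →
               r ^ ∣ e ∣ * ∑ᶜ (λ x → 𝟙 (covers? C e x)) ≡ r ^ n * covering ∣ e ∣ ∣ C ∣ (r ∸ ∣ C ∣)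
count-covers {r} C [] = cong (_+ 0) base
  where
  base : 𝟙 (covers? C [] []) ≡ covering 0 ∣ C ∣ (r ∸ ∣ C ∣)
  base with covers? C [] [] | r ∸ ∣ C ∣ in eq
  ... | yes _   | zero  = refl
  ... | no  _   | suc _ = refl
  ... | yes cov | suc m = contradiction (trans (sym eq) (m≤n⇒m∸n≡0 full)) λ ()
    where
    full : r ≤ ∣ C ∣
    full = ≤-trans (≤-reflexive (sym (∣⊤∣≡n r))) (p⊆q⇒∣p∣≤∣q∣ {p = ⊤} λ {j} _ → [ id , (λ ()) ]′ (cov j))
  ... | no ¬cov | zero  = contradiction (λ j → inj₁ (subst (j ∈_) (sym C≡⊤) ∈⊤)) ¬cov
    where
    C≡⊤ : C ≡ ⊤
    C≡⊤ = ∣p∣≡n⇒p≡⊤ (≤-antisym (∣p∣≤n C) (m∸n≡0⇒m≤n eq))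
count-covers {r} {suc n} C (outside ∷ e) = begin
  r ^ ∣ e ∣ * sum (λ c → ∑ᶜ λ x → 𝟙 (covers? C (outside ∷ e) (c ∷ x)))
    ≡⟨ cong (r ^ ∣ e ∣ *_) (∑.sum-cong-≗ λ c → ∑ᶜ-cong {n = n} λ x →
         𝟙-cong (covers? C (outside ∷ e) (c ∷ x)) (covers? C e x) covers-outside⁻ covers-outside⁺) ⟩
  r ^ ∣ e ∣ * sum {r} (λ _ → N)                     ≡⟨ cong (r ^ ∣ e ∣ *_) (sum-const r) ⟩
  r ^ ∣ e ∣ * (r * N)                               ≡⟨ *.x∙yz≈y∙xz (r ^ ∣ e ∣) r N ⟩
  r * (r ^ ∣ e ∣ * N)                               ≡⟨ cong (r *_) (count-covers C e) ⟩
  r * (r ^ n * covering ∣ e ∣ ∣ C ∣ (r ∸ ∣ C ∣))    ≡⟨ *-assoc r (r ^ n) _ ⟨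
  r * r ^ n * covering ∣ e ∣ ∣ C ∣ (r ∸ ∣ C ∣)      ∎
  where
  open ≡-Reasoning
  N = ∑ᶜ λ x → 𝟙 (covers? C e x)
count-covers {r} {suc n} C (inside ∷ e) = begin
  r * r ^ ∣ e ∣ * sum (λ c → ∑ᶜ λ x → 𝟙 (covers? C (inside ∷ e) (c ∷ x)))
    ≡⟨ cong (r * r ^ ∣ e ∣ *_) (∑.sum-cong-≗ λ c → ∑ᶜ-cong {n = n} λ x →
         𝟙-cong (covers? C (inside ∷ e) (c ∷ x)) (covers? (insert C c) e x) covers-inside⁻ covers-inside⁺) ⟩
  r * r ^ ∣ e ∣ * sum N                                ≡⟨ *-assoc r (r ^ ∣ e ∣) _ ⟩
  r * (r ^ ∣ e ∣ * sum N)                              ≡⟨ cong (r *_) (∑.*-distribˡ-sum (r ^ ∣ e ∣) N) ⟩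
  r * sum (λ c → r ^ ∣ e ∣ * N c)                      ≡⟨ cong (r *_) (∑.sum-cong-≗ λ c → count-covers (insert C c) e) ⟩
  r * sum (λ c → r ^ n * h ∣ insert C c ∣)             ≡⟨ cong (r *_) (∑.*-distribˡ-sum (r ^ n) λ c → h ∣ insert C c ∣) ⟨
  r * (r ^ n * sum (λ c → h ∣ insert C c ∣))           ≡⟨ *-assoc r (r ^ n) _ ⟨
  r ^ suc n * sum (λ c → h ∣ insert C c ∣)             ≡⟨ cong (r ^ suc n *_) (sum-insert C h) ⟩
  r ^ suc n * (∣ C ∣ * h ∣ C ∣ + (r ∸ ∣ C ∣) * h (suc ∣ C ∣))
    ≡⟨ cong (λ z → r ^ suc n * (∣ C ∣ * h ∣ C ∣ + (r ∸ ∣ C ∣) * covering ∣ e ∣ (suc ∣ C ∣) z)) (pred[m∸n]≡m∸[1+n] r ∣ C ∣) ⟨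
  r ^ suc n * covering (suc ∣ e ∣) ∣ C ∣ (r ∸ ∣ C ∣)   ∎
  where
  open ≡-Reasoning
  N : Fin r → ℕ
  N c = ∑ᶜ λ x → 𝟙 (covers? (insert C c) e x)
  h : ℕ → ℕ
  h a = covering ∣ e ∣ a (r ∸ a)

cutting : Subset n → Vec (Fin r) n → ℕ
cutting e x = 𝟙 (isCutEdge? (lookup x) e)

-- A uniformly random colouring cuts an edge with the probability given by `density`; here the
-- denominators are cleared.
count-cutting : ∀ (e : Subset n) → r ^ ∣ e ∣ * ∑ᶜ (cutting {r = r} e) ≡ r ^ n * surjections ∣ e ∣ r
count-cutting {n} {r} e = begin
  r ^ ∣ e ∣ * ∑ᶜ (cutting e)
    ≡⟨ cong (r ^ ∣ e ∣ *_) (∑ᶜ-cong {n = n} λ x →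
         𝟙-cong (isCutEdge? (lookup x) e) (covers? ⊥ e x) (λ cut j → inj₂ (cut j)) (λ cov j → [ (λ j∈⊥ → ⊥-elim (∉⊥ j∈⊥)) , id ]′ (cov j))) ⟩
  r ^ ∣ e ∣ * ∑ᶜ (λ x → 𝟙 (covers? ⊥ e x)) ≡⟨ count-covers ⊥ e ⟩
  r ^ n * h (∣ ⊥ {r} ∣)                    ≡⟨ cong (λ a → r ^ n * h a) (∣⊥∣≡0 r) ⟩
  r ^ n * h 0                              ≡⟨ cong (r ^ n *_) (covering-surjections (∣ e ∣) r) ⟩
  r ^ n * surjections (∣ e ∣) r            ∎
  where
  open ≡-Reasoning
  h : ℕ → ℕ
  h a = covering (∣ e ∣) a (r ∸ a)

-- Colourings in which prescribed pairs of vertices receive different colours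

-- A number and not a decision, so that conditioning on unequal colours becomes multiplication by a
-- weight.
unequal : Fin r → Fin r → ℕ
unequal zero    zero    = 0
unequal zero    (suc b) = 1
unequal (suc a) zero    = 1
unequal (suc a) (suc b) = unequal a b

unequal-sym : (a b : Fin r) → unequal a b ≡ unequal b a
unequal-sym zero    zero    = refl
unequal-sym zero    (suc b) = refl
unequal-sym (suc a) zero    = refl
unequal-sym (suc a) (suc b) = unequal-sym a b

sum-unequal : (a : Fin r) (g : Fin r → ℕ) → sum (λ c → unequal c a * g c) + g a ≡ sum g
sum-unequal {suc r} zero g = begin
  sum (λ c → 1 * g (suc c)) + g zero ≡⟨ cong (_+ g zero) (∑.sum-cong-≗ λ c → *-identityˡ (g (suc c))) ⟩
  sum (g ∘ suc) + g zero             ≡⟨ +-comm (sum (g ∘ suc)) (g zero) ⟩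
  sum g                              ∎
  where open ≡-Reasoning
sum-unequal {suc r} (suc a) g = begin
  1 * g zero + T + g (suc a)     ≡⟨ lem (g zero) T (g (suc a)) ⟩
  g zero + (T + g (suc a))       ≡⟨ cong (g zero +_) (sum-unequal a (g ∘ suc)) ⟩
  sum g                          ∎
  where
  open ≡-Reasoning
  T = sum (λ c → unequal c a * g (suc c))
  lem : ∀ x y z → 1 * x + y + z ≡ x + (y + z)
  lem = solve-∀

sum-unequal-const : (a : Fin (suc q)) (k : ℕ) → sum (λ c → unequal c a * k) ≡ q * k
sum-unequal-const {q} a k = +-cancelʳ-≡ k _ (q * k)
  (trans (sum-unequal a (λ _ → k)) (trans (sum-const (suc q)) (+-comm k (q * k))))

-- Leaving out the smallest of `suc q` values does not lower their average.
sum-unequal-≥ : (a : Fin (suc q)) (g : Fin (suc q) → ℕ) → (∀ c → g a ≤ g c) →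
                q * sum g ≤ suc q * sum (λ c → unequal c a * g c)
sum-unequal-≥ {q} a g ga≤ = begin
  q * sum g           ≡⟨ cong (q *_) (sum-unequal a g) ⟨
  q * (T + g a)       ≡⟨ *-distribˡ-+ q T (g a) ⟩
  q * T + q * g a     ≤⟨ +-monoʳ-≤ (q * T) few ⟩
  q * T + T           ≡⟨ +-comm (q * T) T ⟩
  suc q * T           ∎
  where
  open ≤-Reasoning
  T = sum (λ c → unequal c a * g c)
  few : q * g a ≤ T
  few = begin
    q * g a                         ≡⟨ sum-unequal-const a (g a) ⟨
    sum (λ c → unequal c a * g a)   ≤⟨ sum-mono (λ c → *-monoʳ-≤ (unequal c a) (ga≤ c)) ⟩
    T                               ∎

-- The indicator of the event that every pair gets two different colours; conditioning on it means
-- weighting by it.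
weight : List (Fin n × Fin n) → Vec (Fin r) n → ℕ
weight []            x = 1
weight ((a , b) ∷ L) x = unequal (lookup x a) (lookup x b) * weight L x

IndependentOf : Fin n → (Vec (Fin r) n → ℕ) → Set
IndependentOf a F = ∀ x c → F (x [ a ]≔ c) ≡ F x

Avoids : Fin n → Fin n × Fin n → Set
Avoids a (b , c) = a ≢ b × a ≢ c

weight-independent : ∀ {a : Fin n} {L} → All (Avoids a) L → IndependentOf {r = r} a (weight L)
weight-independent []                     x c = refl
weight-independent ((a≢b , a≢d) ∷ avoids) x c =
  cong₂ _*_ (cong₂ unequal (lookup∘update′ (a≢b ∘ sym) x c) (lookup∘update′ (a≢d ∘ sym) x c))
            (weight-independent avoids x c)

-- The first vertex of each pair occurs in no later pair. It can therefore be recoloured without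
-- affecting the later factors of `weight`, and pairs can be removed from the front.
Free : List (Fin n × Fin n) → Set
Free L = All (λ (a , b) → a ≢ b) L × AllPairs (λ (a , _) → Avoids a) L

resample-weight : ∀ {a b : Fin n} {L} → a ≢ b → All (Avoids a) L → (G : Vec (Fin r) n → ℕ) →
  r * ∑ᶜ (λ x → weight ((a , b) ∷ L) x * G x) ≡
  ∑ᶜ (λ x → sum λ c → unequal c (lookup x b) * (weight L x * G (x [ a ]≔ c)))
resample-weight {n} {r} {a} {b} {L} a≢b avoids G =
  trans (resample a (λ x → weight ((a , b) ∷ L) x * G x))
        (∑ᶜ-cong {n = n} λ x → ∑.sum-cong-≗ λ c → step x c)
  where
  open ≡-Reasoning
  step : ∀ x c → weight ((a , b) ∷ L) (x [ a ]≔ c) * G (x [ a ]≔ c) ≡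
                 unequal c (lookup x b) * (weight L x * G (x [ a ]≔ c))
  step x c = begin
    unequal (lookup (x [ a ]≔ c) a) (lookup (x [ a ]≔ c) b) * weight L (x [ a ]≔ c) * G (x [ a ]≔ c)
      ≡⟨ cong (_* G (x [ a ]≔ c)) (cong₂ _*_
           (cong₂ unequal (lookup∘update a x c) (lookup∘update′ (a≢b ∘ sym) x c))
           (weight-independent avoids x c)) ⟩
    unequal c (lookup x b) * weight L x * G (x [ a ]≔ c)
      ≡⟨ *-assoc (unequal c (lookup x b)) (weight L x) _ ⟩
    unequal c (lookup x b) * (weight L x * G (x [ a ]≔ c)) ∎

-- Colour the first vertex of the front pair last: `q` of its `suc q` colours are allowed, and
-- neither `G` nor the later pairs notice the choice. So each pair is a condition of probability
-- `q / suc q`, independent of `G`.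
∑ᶜ-weight-free : ∀ {L : List (Fin n × Fin n)} {G : Vec (Fin (suc q)) n → ℕ} → Free L →
  All (λ (a , _) → IndependentOf a G) L →
  suc q ^ length L * ∑ᶜ (λ x → weight L x * G x) ≡ q ^ length L * ∑ᶜ G
∑ᶜ-weight-free {n} {q} {[]} {G} free ind =
  cong (_+ 0) (∑ᶜ-cong {n = n} λ x → *-identityˡ (G x))
∑ᶜ-weight-free {n} {q} {(a , b) ∷ L} {G} (a≢b ∷ ≢s , avoids ∷ detached) (ind ∷ inds) = begin
  suc q * suc q ^ l * ∑ᶜ (λ x → weight ((a , b) ∷ L) x * G x)     ≡⟨ *.xy∙z≈y∙xz (suc q) (suc q ^ l) _ ⟩
  suc q ^ l * (suc q * ∑ᶜ (λ x → weight ((a , b) ∷ L) x * G x))   ≡⟨ cong (suc q ^ l *_) first ⟩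
  suc q ^ l * (q * ∑ᶜ (λ x → weight L x * G x))                   ≡⟨ *.x∙yz≈y∙xz (suc q ^ l) q _ ⟩
  q * (suc q ^ l * ∑ᶜ (λ x → weight L x * G x))                   ≡⟨ cong (q *_) (∑ᶜ-weight-free (≢s , detached) inds) ⟩
  q * (q ^ l * ∑ᶜ G)                                              ≡⟨ *-assoc q (q ^ l) _ ⟨
  q * q ^ l * ∑ᶜ G                                                ∎
  where
  open ≡-Reasoning
  l = length L
  first : suc q * ∑ᶜ (λ x → weight ((a , b) ∷ L) x * G x) ≡ q * ∑ᶜ (λ x → weight L x * G x)
  first = begin
    suc q * ∑ᶜ (λ x → weight ((a , b) ∷ L) x * G x) ≡⟨ resample-weight a≢b avoids G ⟩
    ∑ᶜ (λ x → sum λ c → unequal c (lookup x b) * (weight L x * G (x [ a ]≔ c)))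
      ≡⟨ (∑ᶜ-cong {n = n} λ x → trans
            (∑.sum-cong-≗ λ c → cong (λ z → unequal c (lookup x b) * (weight L x * z)) (ind x c))
            (sum-unequal-const (lookup x b) (weight L x * G x))) ⟩
    ∑ᶜ (λ x → q * (weight L x * G x))               ≡⟨ *-distribˡ-∑ᶜ {n = n} q _ ⟨
    q * ∑ᶜ (λ x → weight L x * G x)                 ∎

FavoursUnequal : (Vec (Fin r) n → ℕ) → Fin n × Fin n → Set
FavoursUnequal F (a , b) = ∀ x c → F (x [ a ]≔ lookup x b) ≤ F (x [ a ]≔ c)

-- Conditioning on the pairs does not lower the mean of `F`: each pair forbids its first vertex a
-- colour at which `F` is smallest, so `sum-unequal-≥` applies after resampling that vertex.
∑ᶜ-weight-≥ : ∀ {L : List (Fin n × Fin n)} {F : Vec (Fin (suc q)) n → ℕ} → Free L →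
  All (FavoursUnequal F) L →
  q ^ length L * ∑ᶜ F ≤ suc q ^ length L * ∑ᶜ (λ x → weight L x * F x)
∑ᶜ-weight-≥ {n} {q} {[]} {F} free fav =
  ≤-reflexive (cong (_+ 0) (∑ᶜ-cong {n = n} λ x → sym (*-identityˡ (F x))))
∑ᶜ-weight-≥ {n} {q} {(a , b) ∷ L} {F} (a≢b ∷ ≢s , avoids ∷ detached) (fav ∷ favs) = begin
  q * q ^ l * ∑ᶜ F                    ≡⟨ *-assoc q (q ^ l) _ ⟩
  q * (q ^ l * ∑ᶜ F)                  ≤⟨ *-monoʳ-≤ q (∑ᶜ-weight-≥ (≢s , detached) favs) ⟩
  q * (suc q ^ l * W)                 ≡⟨ *.x∙yz≈y∙xz q (suc q ^ l) W ⟩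
  suc q ^ l * (q * W)                 ≤⟨ *-monoʳ-≤ (suc q ^ l) (*-cancelˡ-≤ (suc q) first) ⟩
  suc q ^ l * (suc q * W′)            ≡⟨ *.xy∙z≈y∙xz (suc q) (suc q ^ l) W′ ⟨
  suc q * suc q ^ l * W′              ∎
  where
  open ≤-Reasoning
  l = length L
  W = ∑ᶜ (λ x → weight L x * F x)
  W′ = ∑ᶜ (λ x → weight ((a , b) ∷ L) x * F x)
  first : suc q * (q * W) ≤ suc q * (suc q * W′)
  first = begin
    suc q * (q * W)                                     ≡⟨ *.x∙yz≈y∙xz (suc q) q W ⟩
    q * (suc q * W)                                     ≡⟨ cong (q *_) (resample a (λ x → weight L x * F x)) ⟩
    q * ∑ᶜ (λ x → sum λ c → weight L (x [ a ]≔ c) * F (x [ a ]≔ c))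
      ≡⟨ cong (q *_) (∑ᶜ-cong {n = n} λ x → ∑.sum-cong-≗ λ c → cong (_* F (x [ a ]≔ c)) (weight-independent avoids x c)) ⟩
    q * ∑ᶜ (λ x → sum λ c → weight L x * F (x [ a ]≔ c)) ≡⟨ *-distribˡ-∑ᶜ {n = n} q _ ⟩
    ∑ᶜ (λ x → q * sum λ c → weight L x * F (x [ a ]≔ c))
      ≤⟨ (∑ᶜ-mono {n = n} λ x → sum-unequal-≥ (lookup x b) (λ c → weight L x * F (x [ a ]≔ c))
            λ c → *-monoʳ-≤ (weight L x) (fav x c)) ⟩
    ∑ᶜ (λ x → suc q * sum λ c → unequal c (lookup x b) * (weight L x * F (x [ a ]≔ c))) ≡⟨ *-distribˡ-∑ᶜ {n = n} (suc q) _ ⟨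
    suc q * ∑ᶜ (λ x → sum λ c → unequal c (lookup x b) * (weight L x * F (x [ a ]≔ c))) ≡⟨ cong (suc q *_) (resample-weight a≢b avoids F) ⟨
    suc q * (suc q * W′)                                ∎

cutting-independent : ∀ {a : Fin n} {e} → a ∉ e → IndependentOf {r = r} a (cutting e)
cutting-independent {a = a} {e} a∉e x c =
  𝟙-cong (isCutEdge? (lookup (x [ a ]≔ c)) e) (isCutEdge? (lookup x) e)
    (λ cut j → let v , v∈e , xv≡j = cut j in v , v∈e , trans (sym (unchanged v∈e)) xv≡j)
    (λ cut j → let v , v∈e , xv≡j = cut j in v , v∈e , trans (unchanged v∈e) xv≡j)
  where
  unchanged : ∀ {v} → v ∈ e → lookup (x [ a ]≔ c) v ≡ lookup x v
  unchanged v∈e = lookup∘update′ (λ { refl → a∉e v∈e }) x c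

-- When `a` has the colour of `b`, the vertex `b` already supplies that colour to `e`, so any other
-- colour on `a` keeps a cut intact.
cutting-favoursUnequal : ∀ {a b : Fin n} {e} → a ≢ b → b ∈ e → FavoursUnequal {r = r} (cutting e) (a , b)
cutting-favoursUnequal {a = a} {b} {e} a≢b b∈e x c =
  𝟙-mono (isCutEdge? (lookup (x [ a ]≔ lookup x b)) e) (isCutEdge? (lookup (x [ a ]≔ c)) e) move
  where
  move : IsCutEdge (lookup (x [ a ]≔ lookup x b)) e → IsCutEdge (lookup (x [ a ]≔ c)) e
  move cut j with cut j
  ... | v , v∈e , xv≡j with v Fin.≟ a
  ...   | yes refl = b , b∈e , trans (lookup∘update′ (a≢b ∘ sym) x c) (trans (sym (lookup∘update a x _)) xv≡j)
  ...   | no  v≢a  = v , v∈e , trans (lookup∘update′ v≢a x c) (trans (sym (lookup∘update′ v≢a x _)) xv≡j)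

erase : Subset n → Fin n → Subset n
erase e a = e [ a ]≔ outside

∣erase∣ : ∀ {e : Subset n} {a} → a ∈ e → suc ∣ erase e a ∣ ≡ ∣ e ∣
∣erase∣ {e = inside  ∷ e} here        = refl
∣erase∣ {e = inside  ∷ e} (there a∈e) = cong suc (∣erase∣ a∈e)
∣erase∣ {e = outside ∷ e} (there a∈e) = ∣erase∣ a∈e

∈-erase⁺ : ∀ {e : Subset n} {a v} → v ≢ a → v ∈ e → v ∈ erase e a
∈-erase⁺ {e = e} {a} {v} v≢a v∈e = []≔-minimal e v a v≢a v∈e

∈-erase⁻ : ∀ {e : Subset n} {a v} → v ∈ erase e a → v ≢ a × v ∈ e
∈-erase⁻ {e = e} {a} {v} v∈ = v≢a , lookup⇒[]= v e (trans (sym (lookup∘update′ v≢a e outside)) ([]=⇒lookup v∈))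
  where
  v≢a : v ≢ a
  v≢a refl with () ← []=-injective v∈ ([]≔-updates e a)

-- Once `a` repeats the colour of `b`, it supplies no colour that `b` does not.
cutting-erase : ∀ {a b : Fin n} {e} → a ≢ b → b ∈ e → (x : Vec (Fin r) n) →
                cutting e (x [ a ]≔ lookup x b) ≡ cutting (erase e a) x
cutting-erase {a = a} {b} {e} a≢b b∈e x =
  𝟙-cong (isCutEdge? (lookup (x [ a ]≔ lookup x b)) e) (isCutEdge? (lookup x) (erase e a)) to from
  where
  to : IsCutEdge (lookup (x [ a ]≔ lookup x b)) e → IsCutEdge (lookup x) (erase e a)
  to cut j with cut j
  ... | v , v∈e , xv≡j with v Fin.≟ a
  ...   | yes refl = b , ∈-erase⁺ (a≢b ∘ sym) b∈e , trans (sym (lookup∘update a x _)) xv≡j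
  ...   | no  v≢a  = v , ∈-erase⁺ v≢a v∈e , trans (sym (lookup∘update′ v≢a x _)) xv≡j
  from : IsCutEdge (lookup x) (erase e a) → IsCutEdge (lookup (x [ a ]≔ lookup x b)) e
  from cut j = let v , v∈ , xv≡j = cut j
                   v≢a , v∈e = ∈-erase⁻ v∈
               in v , v∈e , trans (lookup∘update′ v≢a x _) xv≡j

-- Colour a last: equal colours on a and b turn a cut of e into a cut of e without a.
count-cutting-unequal : ∀ {a b : Fin n} {e} → a ≢ b → a ∈ e → b ∈ e → ∀ {k} → ∣ e ∣ ≡ suc k →
  suc q ^ suc k * (suc q * ∑ᶜ (λ x → unequal (lookup x a) (lookup x b) * cutting {r = suc q} e x)) ≡
  suc q ^ n * (q * surjections (suc k) (suc q) + suc q * surjections k q)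
count-cutting-unequal {n} {q} {a} {b} {e} a≢b a∈e b∈e {k} ∣e∣≡ =
  +-cancelʳ-≡ (suc q ^ suc k * E) _ _ (begin
    R ^ suc k * (R * U) + R ^ suc k * E        ≡⟨ *-distribˡ-+ (R ^ suc k) (R * U) E ⟨
    R ^ suc k * (R * U + E)                    ≡⟨ cong (R ^ suc k *_) total ⟩
    R ^ suc k * (R * ∑ᶜ (cutting e))           ≡⟨ *.x∙yz≈y∙xz (R ^ suc k) R _ ⟩
    R * (R ^ suc k * ∑ᶜ (cutting e))           ≡⟨ cong (λ t → R * (R ^ t * ∑ᶜ (cutting e))) ∣e∣≡ ⟨
    R * (R ^ ∣ e ∣ * ∑ᶜ (cutting e))           ≡⟨ cong (R *_) (count-cutting e) ⟩
    R * (R ^ n * surjections (∣ e ∣) R)        ≡⟨ cong (λ t → R * (R ^ n * surjections t R)) ∣e∣≡ ⟩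
    R * (R ^ n * σ)                            ≡⟨ lem q (R ^ n) σ ⟩
    -- One of the `suc q` copies of `σ` is split by `surjections-suc`; its `σ₁` part is exactly what
    -- the cuts with equal colours on `a` and `b` account for, and it is cancelled against `E`.
    R ^ n * (q * σ + σ)                        ≡⟨ cong (λ z → R ^ n * (q * σ + z)) (surjections-suc k q) ⟩
    R ^ n * (q * σ + R * (σ₁ + σ₂))            ≡⟨ lem₂ q (R ^ n) σ σ₁ σ₂ ⟩
    R ^ n * (q * σ + R * σ₂) + R * (R ^ n * σ₁) ≡⟨ cong (λ z → R ^ n * (q * σ + R * σ₂) + R * z) erased ⟨
    R ^ n * (q * σ + R * σ₂) + R * (R ^ k * E) ≡⟨ cong (R ^ n * (q * σ + R * σ₂) +_) (*-assoc R (R ^ k) E) ⟨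
    R ^ n * (q * σ + R * σ₂) + R ^ suc k * E   ∎)
  where
  open ≡-Reasoning
  R = suc q
  σ = surjections (suc k) R
  σ₁ = surjections k R
  σ₂ = surjections k q
  U = ∑ᶜ (λ x → unequal (lookup x a) (lookup x b) * cutting {r = R} e x)
  E = ∑ᶜ (cutting {r = R} (erase e a))
  lem : ∀ q N s → suc q * (N * s) ≡ N * (q * s + s)
  lem = solve-∀
  lem₂ : ∀ q N s s₁ s₂ → N * (q * s + suc q * (s₁ + s₂)) ≡ N * (q * s + suc q * s₂) + suc q * (N * s₁)
  lem₂ = solve-∀
  ∣erase∣≡ : ∣ erase e a ∣ ≡ k
  ∣erase∣≡ = suc-injective (trans (∣erase∣ a∈e) ∣e∣≡)
  erased : R ^ k * E ≡ R ^ n * σ₁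
  erased = trans (cong (λ t → R ^ t * E) (sym ∣erase∣≡))
                 (trans (count-cutting (erase e a)) (cong (λ t → R ^ n * surjections t R) ∣erase∣≡))
  g : Vec (Fin R) n → Fin R → ℕ
  g x c = cutting e (x [ a ]≔ c)
  total : R * U + E ≡ R * ∑ᶜ (cutting e)
  total = begin
    R * U + E
      ≡⟨ cong₂ _+_ (resample a _) (∑ᶜ-cong {n = n} λ x → sym (cutting-erase a≢b b∈e x)) ⟩
    ∑ᶜ (λ x → sum λ c → unequal (lookup (x [ a ]≔ c) a) (lookup (x [ a ]≔ c) b) * g x c) + ∑ᶜ (λ x → g x (lookup x b))
      ≡⟨ ∑ᶜ-distrib-+ {n = n} _ _ ⟨
    ∑ᶜ (λ x → sum (λ c → unequal (lookup (x [ a ]≔ c) a) (lookup (x [ a ]≔ c) b) * g x c) + g x (lookup x b))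
      ≡⟨ (∑ᶜ-cong {n = n} λ x → trans
           (cong (_+ g x (lookup x b)) (∑.sum-cong-≗ λ c → cong (_* g x c)
             (cong₂ unequal (lookup∘update a x c) (lookup∘update′ (a≢b ∘ sym) x c))))
           (sum-unequal (lookup x b) (g x))) ⟩
    ∑ᶜ (λ x → sum (g x))
      ≡⟨ resample a (cutting e) ⟨
    R * ∑ᶜ (cutting e) ∎

-- The expected size of a cut along a star forest

record Link (n : ℕ) : Set where
  constructor link
  field
    leaf centre : Fin n
    edge        : Subset n
open Link

-- The first vertex is the one to be resampled. `ends⁻` serves the links whose centre lies outside
-- the edge under consideration.
ends ends⁻ : Link n → Fin n × Fin n
ends  s = leaf s , centre s
ends⁻ s = centre s , leaf s

-- By `leaf≢centre` no leaf is also a centre, so with distinct leaves the links form disjoint stars.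
-- `edges-unique` lets every link claim its gain at an edge of its own. `separated` makes the
-- centres distinct among links whose leaves lie in a common edge.
record StarForest {k} (H : Hypergraph k n) (S : List (Link n)) : Set where
  field
    leaves-unique : AllPairs (λ s t → leaf s ≢ leaf t) S
    edges-unique  : AllPairs (λ s t → edge s ≢ edge t) S
    leaf≢centre   : ∀ {s t} → s ∈ˡ S → t ∈ˡ S → leaf s ≢ centre t
    incident      : ∀ {s} → s ∈ˡ S → edge s ∈ˡ edges H × leaf s ∈ edge s × centre s ∈ edge s
    separated     : ∀ {s t e} → s ∈ˡ S → t ∈ˡ S → e ∈ˡ edges H → leaf s ∈ e → leaf t ∈ e →
                    centre s ≡ centre t → leaf s ≡ leaf t

AllPairs-mapWith∈ : ∀ {A : Set} {P Q : A → A → Set} {xs} →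
  (∀ {x y} → x ∈ˡ xs → y ∈ˡ xs → P x y → Q x y) → AllPairs P xs → AllPairs Q xs
AllPairs-mapWith∈ f []         = []
AllPairs-mapWith∈ f (px ∷ pxs) =
  All.tabulate (λ y∈ → f (here refl) (there y∈) (All.lookup px y∈)) ∷
  AllPairs-mapWith∈ (λ x∈ y∈ → f (there x∈) (there y∈)) pxs

free-map : ∀ {xs : List (Link n)} (f : Link n → Fin n × Fin n) →
  (∀ {s} → s ∈ˡ xs → proj₁ (f s) ≢ proj₂ (f s)) →
  (∀ {s t} → s ∈ˡ xs → t ∈ˡ xs → leaf s ≢ leaf t → Avoids (proj₁ (f s)) (f t)) →
  AllPairs (λ s t → leaf s ≢ leaf t) xs → Free (map f xs)
free-map f ≢s avoids unique =
  All.map⁺ (All.tabulate ≢s) , AllPairs.map⁺ (AllPairs-mapWith∈ avoids unique)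

module _ {A : Set} {P : A → Set} (P? : ∀ a → Dec (P a)) where

  private
    yeses noes : List A → List A
    yeses = filter P?
    noes  = filter (¬? ∘ P?)

  length-split : ∀ xs → length xs ≡ length (noes xs) + length (yeses xs)
  length-split [] = refl
  length-split (a ∷ xs) with P? a
  ... | yes _ = trans (cong suc (length-split xs)) (sym (+-suc (length (noes xs)) (length (yeses xs))))
  ... | no  _ = cong suc (length-split xs)

  weight-split : (f : A → Fin n × Fin n) (x : Vec (Fin r) n) → ∀ xs →
    weight (map f xs) x ≡ weight (map f (noes xs)) x * weight (map f (yeses xs)) x
  weight-split f x [] = refl
  weight-split f x (a ∷ xs) with P? a
  ... | yes _ = trans (cong (u *_) (weight-split f x xs)) (*.x∙yz≈y∙xz u (weight (map f (noes xs)) x) (weight (map f (yeses xs)) x))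
    where
    u = unequal (lookup x (proj₁ (f a))) (lookup x (proj₂ (f a)))
  ... | no  _ = trans (cong (u *_) (weight-split f x xs)) (sym (*-assoc u _ _))
    where u = unequal (lookup x (proj₁ (f a))) (lookup x (proj₂ (f a)))

weight-ends⁻ : (x : Vec (Fin r) n) → ∀ S → weight (map ends⁻ S) x ≡ weight (map ends S) x
weight-ends⁻ x []      = refl
weight-ends⁻ x (s ∷ S) = cong₂ _*_ (unequal-sym (lookup x (centre s)) (lookup x (leaf s))) (weight-ends⁻ x S)

module _ {κ} {H : Hypergraph κ n} {S : List (Link n)} (forest : StarForest H S) where
  open StarForest forest

  forest-free : ∀ {L} → (∀ {s} → s ∈ˡ L → s ∈ˡ S) → AllPairs (λ s t → leaf s ≢ leaf t) L →
                Free (map ends L)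
  forest-free L⊆S = free-map ends (λ s∈ → leaf≢centre (L⊆S s∈) (L⊆S s∈))
                                  (λ s∈ t∈ leaf≢ → leaf≢ , leaf≢centre (L⊆S s∈) (L⊆S t∈))

  -- The probability that all links are satisfied is `(q / suc q) ^ length S`, by `∑ᶜ-weight-free`
  -- for the constant 1.
  ∑ᶜ-forest : suc q ^ length S * ∑ᶜ (weight {r = suc q} (map ends S)) ≡ q ^ length S * suc q ^ n
  ∑ᶜ-forest {q} = begin
    suc q ^ length S * ∑ᶜ w                            ≡⟨ cong₂ (λ m z → suc q ^ m * z) (length-map ends S) (∑ᶜ-cong {n = n} λ x → *-identityʳ (w x)) ⟨
    suc q ^ length (map ends S) * ∑ᶜ (λ x → w x * 1)   ≡⟨ ∑ᶜ-weight-free (forest-free id leaves-unique) (All.universal (λ _ _ _ → refl) _) ⟩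
    q ^ length (map ends S) * ∑ᶜ {suc q} {n} (λ _ → 1) ≡⟨ cong₂ (λ m z → q ^ m * z) (length-map ends S) (trans (∑ᶜ-const {suc q} {n} 1) (*-identityʳ _)) ⟩
    q ^ length S * suc q ^ n                           ∎
    where
    open ≡-Reasoning
    w = weight {r = suc q} (map ends S)

  module _ {e} (e∈H : e ∈ˡ edges H) where

    private
      leaf? : ∀ s → Dec (leaf s ∈ e)
      leaf? s = leaf s ∈? e
      centre? : ∀ s → Dec (centre s ∈ e)
      centre? s = centre s ∈? e
      -- `L₁` has its leaves outside `e`, `L₂` has leaves inside and centres outside, and `L₃` lies
      -- inside `e`. The links are removed in this order, resampling leaves in `L₁` and centres in
      -- `L₂`; these vertices are outside `e`, so only `L₃` influences whether `e` is cut.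
      L₁ L′ L₂ L₃ : List (Link n)
      L₁ = filter (¬? ∘ leaf?) S
      L′ = filter leaf? S
      L₂ = filter (¬? ∘ centre?) L′
      L₃ = filter centre? L′

      ∈L₁ : ∀ {s} → s ∈ˡ L₁ → s ∈ˡ S × leaf s ∉ e
      ∈L₁ = ∈-filter⁻ (¬? ∘ leaf?)
      ∈L₂ : ∀ {s} → s ∈ˡ L₂ → s ∈ˡ S × leaf s ∈ e × centre s ∉ e
      ∈L₂ s∈ = let s∈L′ , c∉ = ∈-filter⁻ (¬? ∘ centre?) {xs = L′} s∈
                   s∈S , l∈ = ∈-filter⁻ leaf? s∈L′
               in s∈S , l∈ , c∉
      ∈L₃ : ∀ {s} → s ∈ˡ L₃ → s ∈ˡ S × leaf s ∈ e × centre s ∈ e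
      ∈L₃ s∈ = let s∈L′ , c∈ = ∈-filter⁻ centre? {xs = L′} s∈
                   s∈S , l∈ = ∈-filter⁻ leaf? s∈L′
               in s∈S , l∈ , c∈

      free₁ : Free (map ends L₁)
      free₁ = forest-free (proj₁ ∘ ∈L₁) (AllPairs.filter⁺ (¬? ∘ leaf?) leaves-unique)

      -- The leaves of `L₂` all lie in `e`, so by `separated` different leaves have different
      -- centres, as resampling the centres requires.
      free₂ : Free (map ends⁻ L₂)
      free₂ = free-map ends⁻ (λ s∈ → ≢-sym (leaf≢centre (proj₁ (∈L₂ s∈)) (proj₁ (∈L₂ s∈))))
        (λ s∈ t∈ leaf≢ → let s∈S , ls∈e , _ = ∈L₂ s∈ ; t∈S , lt∈e , _ = ∈L₂ t∈ in
          (λ c≡ → leaf≢ (separated s∈S t∈S e∈H ls∈e lt∈e c≡)) , ≢-sym (leaf≢centre t∈S s∈S))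
        (AllPairs.filter⁺ (¬? ∘ centre?) (AllPairs.filter⁺ leaf? leaves-unique))

      free₃ : Free (map ends L₃)
      free₃ = forest-free (proj₁ ∘ ∈L₃) (AllPairs.filter⁺ centre? (AllPairs.filter⁺ leaf? leaves-unique))

      ≢-∉ : ∀ {a b : Fin n} → a ∉ e → b ∈ e → a ≢ b
      ≢-∉ a∉e b∈e refl = a∉e b∈e

      avoids-map : ∀ {a : Fin n} {L} → (∀ {t} → t ∈ˡ L → Avoids a (ends t)) → All (Avoids a) (map ends L)
      avoids-map f = All.map⁺ (All.tabulate f)

      module _ {r : ℕ} where
        w₁ w₂ w₃ F : Vec (Fin r) n → ℕ
        w₁ = weight (map ends L₁)
        w₂ = weight (map ends L₂)
        w₃ = weight (map ends L₃)
        F  = cutting e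

        ind₁ : All (λ (a , _) → IndependentOf a (λ x → w₂ x * (w₃ x * F x))) (map ends L₁)
        ind₁ = All.map⁺ (All.tabulate λ s∈ x c → let s∈S , l∉ = ∈L₁ s∈ in
          cong₂ _*_
            (weight-independent (avoids-map λ t∈ → let t∈S , lt∈ , _ = ∈L₂ t∈ in ≢-∉ l∉ lt∈ , leaf≢centre s∈S t∈S) x c)
            (cong₂ _*_
              (weight-independent (avoids-map λ t∈ → let t∈S , lt∈ , _ = ∈L₃ t∈ in ≢-∉ l∉ lt∈ , leaf≢centre s∈S t∈S) x c)
              (cutting-independent l∉ x c)))

        ind₂ : All (λ (a , _) → IndependentOf a (λ x → w₃ x * F x)) (map ends⁻ L₂)
        ind₂ = All.map⁺ (All.tabulate λ s∈ x c → let _ , _ , c∉ = ∈L₂ s∈ in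
          cong₂ _*_
            (weight-independent (avoids-map λ t∈ → let _ , lt∈ , ct∈ = ∈L₃ t∈ in ≢-∉ c∉ lt∈ , ≢-∉ c∉ ct∈) x c)
            (cutting-independent c∉ x c))

        weight-factors : ∀ x → weight (map ends S) x * F x ≡ w₁ x * (w₂ x * (w₃ x * F x))
        weight-factors x = begin
          weight (map ends S) x * F x              ≡⟨ cong (_* F x) (weight-split leaf? ends x S) ⟩
          w₁ x * weight (map ends L′) x * F x      ≡⟨ cong (λ z → w₁ x * z * F x) (weight-split centre? ends x L′) ⟩
          w₁ x * (w₂ x * w₃ x) * F x               ≡⟨ lem (w₁ x) (w₂ x) (w₃ x) (F x) ⟩
          w₁ x * (w₂ x * (w₃ x * F x))             ∎
          where
          open ≡-Reasoning
          lem : ∀ a b c d → a * (b * c) * d ≡ a * (b * (c * d))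
          lem = solve-∀

      m₁₂ : ℕ
      m₁₂ = length L₁ + length L₂

      length-parts : length S ≡ m₁₂ + length L₃
      length-parts = trans (length-split leaf? S)
        (trans (cong (length L₁ +_) (length-split centre? L′)) (sym (+-assoc (length L₁) _ _)))

      -- The links of `L₁` and then those of `L₂` are independent of what remains, and each
      -- contributes a factor `q / suc q`.
      reduce : suc q ^ m₁₂ * ∑ᶜ (λ x → weight {r = suc q} (map ends S) x * F x) ≡ q ^ m₁₂ * ∑ᶜ (λ x → w₃ {suc q} x * F x)
      reduce {q} = begin
        R ^ m₁₂ * ∑ᶜ (λ x → weight {r = R} (map ends S) x * F x) ≡⟨ cong (R ^ m₁₂ *_) (∑ᶜ-cong {n = n} weight-factors) ⟩
        R ^ m₁₂ * A₁                                        ≡⟨ cong (_* A₁) (^-distribˡ-+-* R (length L₁) (length L₂)) ⟩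
        R ^ length L₁ * R ^ length L₂ * A₁                  ≡⟨ *.xy∙z≈y∙xz (R ^ length L₁) (R ^ length L₂) A₁ ⟩
        R ^ length L₂ * (R ^ length L₁ * A₁)                ≡⟨ cong (R ^ length L₂ *_) step₁ ⟩
        R ^ length L₂ * (q ^ length L₁ * A₂)                ≡⟨ *.x∙yz≈y∙xz (R ^ length L₂) (q ^ length L₁) A₂ ⟩
        q ^ length L₁ * (R ^ length L₂ * A₂)                ≡⟨ cong (q ^ length L₁ *_) step₂ ⟩
        q ^ length L₁ * (q ^ length L₂ * A₃)                ≡⟨ *-assoc (q ^ length L₁) (q ^ length L₂) A₃ ⟨
        q ^ length L₁ * q ^ length L₂ * A₃                  ≡⟨ cong (_* A₃) (^-distribˡ-+-* q (length L₁) (length L₂)) ⟨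
        q ^ m₁₂ * A₃                                        ∎
        where
        open ≡-Reasoning
        R = suc q
        A₁ = ∑ᶜ (λ x → w₁ {R} x * (w₂ x * (w₃ x * F x)))
        A₂ = ∑ᶜ (λ x → w₂ {R} x * (w₃ x * F x))
        A₃ = ∑ᶜ (λ x → w₃ {R} x * F x)
        step₁ : R ^ length L₁ * A₁ ≡ q ^ length L₁ * A₂
        step₁ = subst (λ m → R ^ m * A₁ ≡ q ^ m * A₂) (length-map ends L₁) (∑ᶜ-weight-free free₁ ind₁)
        step₂ : R ^ length L₂ * A₂ ≡ q ^ length L₂ * A₃
        step₂ = subst (λ m → R ^ m * A₂ ≡ q ^ m * A₃) (length-map ends⁻ L₂)
          (trans (cong (R ^ length (map ends⁻ L₂) *_) (∑ᶜ-cong {n = n} λ x → cong (_* (w₃ x * F x)) (sym (weight-ends⁻ x L₂))))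
                 (∑ᶜ-weight-free free₂ ind₂))

      -- Lifts a bound that involves only `L₃`, with `b` links, to all `m` links of `S` by means of
      -- `reduce`. The parameters `c`, `K` and `B` let it serve both edges with a chosen link and
      -- arbitrary edges.
      combine : ∀ {q a m B c K W W₃} b → suc q ^ a * W ≡ q ^ a * W₃ → m ≡ a + b →
                q ^ b * B ≤ c * (suc q ^ b * (K * W₃)) → q ^ m * B ≤ c * (suc q ^ m * (K * W))
      combine {q} {a} {m} {B} {c} {K} {W} {W₃} b eq refl le = begin
        q ^ (a + b) * B                           ≡⟨ cong (_* B) (^-distribˡ-+-* q a b) ⟩
        q ^ a * q ^ b * B                         ≡⟨ *-assoc (q ^ a) (q ^ b) B ⟩
        q ^ a * (q ^ b * B)                       ≤⟨ *-monoʳ-≤ (q ^ a) le ⟩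
        q ^ a * (c * (suc q ^ b * (K * W₃)))      ≡⟨ lem (q ^ a) c (suc q ^ b) K W₃ ⟩
        c * (suc q ^ b * (K * (q ^ a * W₃)))      ≡⟨ cong (λ z → c * (suc q ^ b * (K * z))) eq ⟨
        c * (suc q ^ b * (K * (suc q ^ a * W)))   ≡⟨ lem₂ (suc q ^ a) c (suc q ^ b) K W ⟩
        c * (suc q ^ a * suc q ^ b * (K * W))     ≡⟨ cong (λ z → c * (z * (K * W))) (^-distribˡ-+-* (suc q) a b) ⟨
        c * (suc q ^ (a + b) * (K * W))           ∎
        where
        open ≤-Reasoning
        lem : ∀ x c y K w → x * (c * (y * (K * w))) ≡ c * (y * (K * (x * w)))
        lem = solve-∀
        lem₂ : ∀ x c y K w → c * (y * (K * (x * w))) ≡ c * (x * y * (K * w))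
        lem₂ = solve-∀

    -- The conditional probability that `e` is cut is at least the unconditional one, since every
    -- link of `L₃` favours cutting `e`. The factor 1 is there to fit `combine`.
    ∑ᶜ-edge-≥ : ∀ {k} → ∣ e ∣ ≡ k →
      q ^ length S * (suc q ^ n * surjections k (suc q)) ≤
      1 * (suc q ^ length S * (suc q ^ k * ∑ᶜ (λ x → weight {r = suc q} (map ends S) x * cutting e x)))
    ∑ᶜ-edge-≥ {q} refl = combine {c = 1} {K = suc q ^ ∣ e ∣} (length L₃) reduce length-parts (begin
      q ^ length L₃ * (R ^ n * surjections (∣ e ∣) R)     ≡⟨ cong (q ^ length L₃ *_) (count-cutting e) ⟨
      q ^ length L₃ * (R ^ ∣ e ∣ * ∑ᶜ F)                  ≡⟨ *.x∙yz≈y∙xz (q ^ length L₃) (R ^ ∣ e ∣) (∑ᶜ F) ⟩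
      R ^ ∣ e ∣ * (q ^ length L₃ * ∑ᶜ F)                  ≤⟨ *-monoʳ-≤ (R ^ ∣ e ∣) few ⟩
      R ^ ∣ e ∣ * (R ^ length L₃ * W₃)                    ≡⟨ swap₁ (R ^ ∣ e ∣) (R ^ length L₃) W₃ ⟩
      1 * (R ^ length L₃ * (R ^ ∣ e ∣ * W₃))              ∎)
      where
      open ≤-Reasoning
      R = suc q
      W₃ = ∑ᶜ (λ x → w₃ {R} x * F x)
      swap₁ : ∀ a b c → a * (b * c) ≡ 1 * (b * (a * c))
      swap₁ = solve-∀
      few : q ^ length L₃ * ∑ᶜ (F {R}) ≤ R ^ length L₃ * W₃
      few = subst (λ m → q ^ m * ∑ᶜ (F {R}) ≤ R ^ m * W₃) (length-map ends L₃)
        (∑ᶜ-weight-≥ free₃ (All.map⁺ (All.tabulate λ s∈ → let s∈S , _ , c∈ = ∈L₃ s∈ in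
          cutting-favoursUnequal (leaf≢centre s∈S s∈S) c∈)))

    -- One link inside `e` is evaluated exactly by `count-cutting-unequal`, and the other links of
    -- `L₃` do not lower the result. Dividing by `q` and the powers of `suc q` shows a gain of
    -- `surjections k q / (q * suc q ^ k)` over the unconditional probability.
    ∑ᶜ-linked-edge-≥ : ∀ {k s} → ∣ e ∣ ≡ suc k → s ∈ˡ S → leaf s ∈ e → centre s ∈ e →
      q ^ length S * (suc q ^ n * (q * surjections (suc k) (suc q) + suc q * surjections k q)) ≤
      q * (suc q ^ length S * (suc q ^ suc k * ∑ᶜ (λ x → weight {r = suc q} (map ends S) x * cutting e x)))
    ∑ᶜ-linked-edge-≥ {q} {k} {s} ∣e∣≡ s∈S l∈e c∈e =
      combine {c = q} {K = R ^ suc k} (length L₃) reduce length-parts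
        (linked L₃ ∈L₃ free₃ (∈-filter⁺ centre? (∈-filter⁺ leaf? s∈S l∈e) c∈e))
      where
      open ≤-Reasoning
      R = suc q
      B = q * surjections (suc k) R + R * surjections k q
      linked : ∀ L → (∀ {t} → t ∈ˡ L → t ∈ˡ S × leaf t ∈ e × centre t ∈ e) → Free (map ends L) → s ∈ˡ L →
        q ^ length L * (R ^ n * B) ≤ q * (R ^ length L * (R ^ suc k * ∑ᶜ (λ x → weight {r = R} (map ends L) x * F x)))
      -- The membership of `s` makes `L₃` nonempty; the link evaluated exactly is the first one,
      -- `t`, whose leaf avoids all later links.
      linked (t ∷ L) ∈L (l≢c ∷ ≢s , avoids ∷ detached) _ = begin
        q * q ^ length L * (R ^ n * B)                    ≡⟨ cong (q * q ^ length L *_) (count-cutting-unequal l≢c (proj₁ t∈e) (proj₂ t∈e) ∣e∣≡) ⟨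
        q * q ^ length L * (R ^ suc k * (R * U))          ≡⟨ lem q (q ^ length L) (R ^ suc k) R U ⟩
        q * (R * (R ^ suc k * (q ^ length L * U)))        ≤⟨ *-monoʳ-≤ q (*-monoʳ-≤ R (*-monoʳ-≤ (R ^ suc k) more)) ⟩
        q * (R * (R ^ suc k * (R ^ length L * W)))        ≡⟨ lem₂ q R (R ^ suc k) (R ^ length L) W ⟩
        q * (R * R ^ length L * (R ^ suc k * W))          ≡⟨ cong (λ z → q * (R * R ^ length L * (R ^ suc k * z))) (∑ᶜ-cong {n = n} λ x → reorder (u x) (w x) (F x)) ⟩
        q * (R * R ^ length L * (R ^ suc k * ∑ᶜ (λ x → u x * w x * F x))) ∎
        where
        t∈S = proj₁ (∈L (here refl))
        t∈e = proj₂ (∈L (here refl))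
        u w : Vec (Fin R) n → ℕ
        u x = unequal (lookup x (leaf t)) (lookup x (centre t))
        w = weight (map ends L)
        U = ∑ᶜ (λ x → u x * F x)
        W = ∑ᶜ (λ x → w x * (u x * F x))
        reorder : ∀ u w f → w * (u * f) ≡ u * w * f
        reorder = solve-∀
        lem : ∀ q a K R U → q * a * (K * (R * U)) ≡ q * (R * (K * (a * U)))
        lem = solve-∀
        lem₂ : ∀ q R K a W → q * (R * (K * (a * W))) ≡ q * (R * a * (K * W))
        lem₂ = solve-∀
        -- Recolouring the leaf of `s` changes neither end of `t`, so `u` stays constant and only
        -- the cut matters.
        favours : ∀ {s} → s ∈ˡ L → Avoids (leaf t) (ends s) → FavoursUnequal (λ x → u x * F x) (ends s)
        favours {s} s∈ (lt≢ls , lt≢cs) x c = *-mono-≤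
          (≤-reflexive (cong₂ unequal
            (trans (lookup∘update′ lt≢ls x _) (sym (lookup∘update′ lt≢ls x _)))
            (trans (lookup∘update′ ct≢ls x _) (sym (lookup∘update′ ct≢ls x _)))))
          (cutting-favoursUnequal (leaf≢centre s∈S′ s∈S′) cs∈e x c)
          where
          s∈S′ = proj₁ (∈L (there s∈))
          cs∈e = proj₂ (proj₂ (∈L (there s∈)))
          ct≢ls = ≢-sym (leaf≢centre s∈S′ t∈S)
        more : q ^ length L * U ≤ R ^ length L * W
        more = subst (λ m → q ^ m * U ≤ R ^ m * W) (length-map ends L)
          (∑ᶜ-weight-≥ (≢s , detached)
            (All.map⁺ (All.tabulate λ s∈ → favours s∈ (All.lookup (All.map⁻ avoids) s∈))))

-- Summing the gain over all edges

_≟ˢ_ : (p q : Subset n) → Dec (p ≡ q)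
_≟ˢ_ = ≡-dec Bool._≟_

length-filter-∷ : ∀ {A : Set} {P : A → Set} (P? : ∀ a → Dec (P a)) a xs →
                  length (filter P? (a ∷ xs)) ≡ 𝟙 (P? a) + length (filter P? xs)
length-filter-∷ P? a xs with P? a
... | yes _ = refl
... | no  _ = refl

-- Links are counted by the edge they record and not by containment: a link may lie inside several
-- edges, but its gain is claimed once.
hits : List (Link n) → Subset n → ℕ
hits []      e = 0
hits (s ∷ S) e = 𝟙 (edge s ≟ˢ e) + hits S e

hits-cases : ∀ {S : List (Link n)} → AllPairs (λ s t → edge s ≢ edge t) S → ∀ e →
             hits S e ≡ 0 ⊎ (hits S e ≡ 1 × ∃[ s ] (s ∈ˡ S × edge s ≡ e))
hits-cases [] e = inj₁ refl
hits-cases {S = s ∷ S} (≢s ∷ unique) e with edge s ≟ˢ e | hits-cases unique e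
... | no  _    | inj₁ none              = inj₁ none
... | no  _    | inj₂ (one , t , t∈ , eq) = inj₂ (one , t , there t∈ , eq)
... | yes refl | inj₁ none              = inj₂ (cong suc none , s , here refl , refl)
... | yes refl | inj₂ (_ , t , t∈ , eq) = contradiction (sym eq) (All.lookup ≢s t∈)

sum-map-+ : ∀ {A : Set} (f g : A → ℕ) xs →
            ℕ-sum (map (λ a → f a + g a) xs) ≡ ℕ-sum (map f xs) + ℕ-sum (map g xs)
sum-map-+ f g []       = refl
sum-map-+ f g (a ∷ xs) = trans (cong (f a + g a +_) (sum-map-+ f g xs)) (lem (f a) (g a) _ _)
  where
  lem : ∀ a b c d → a + b + (c + d) ≡ a + c + (b + d)
  lem = solve-∀

sum-map-∈ : ∀ {A : Set} (f : A → ℕ) {a xs} → a ∈ˡ xs → f a ≤ ℕ-sum (map f xs)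
sum-map-∈ f (here refl) = m≤m+n _ _
sum-map-∈ f (there a∈)  = ≤-trans (sum-map-∈ f a∈) (m≤n+m _ _)

length≤hits : ∀ {S : List (Link n)} {es} → (∀ {s} → s ∈ˡ S → edge s ∈ˡ es) →
              length S ≤ ℕ-sum (map (hits S) es)
length≤hits {S = []}    _  = z≤n
length≤hits {S = s ∷ S} {es} S⊆ = begin
  1 + length S                                     ≤⟨ +-mono-≤ one (length≤hits (S⊆ ∘ there)) ⟩
  ℕ-sum (map (λ e → 𝟙 (edge s ≟ˢ e)) es) + ℕ-sum (map (hits S) es)
    ≡⟨ sum-map-+ (λ e → 𝟙 (edge s ≟ˢ e)) (hits S) es ⟨
  ℕ-sum (map (hits (s ∷ S)) es)                 ∎
  where
  open ≤-Reasoning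
  one : 1 ≤ ℕ-sum (map (λ e → 𝟙 (edge s ≟ˢ e)) es)
  one = ≤-trans (self (edge s ≟ˢ edge s)) (sum-map-∈ (λ e → 𝟙 (edge s ≟ˢ e)) (S⊆ (here refl)))
    where
    self : (d : Dec (edge s ≡ edge s)) → 1 ≤ 𝟙 d
    self (yes _) = s≤s z≤n
    self (no ≢)  = contradiction refl ≢

-- After division by `q * suc q ^ suc k`, the excess is at least `length S` times the gain of a
-- linked edge. Linearity of expectation over the edges bounds the weighted mean of the cut size,
-- and `averaging` picks a colouring.
forest-cut : ∀ {k} {H : Hypergraph (suc k) n} {S} → StarForest H S → 1 ≤ q →
  ∃[ f ] q * surjections (suc k) (suc q) * numEdges H + suc q * surjections k q * length S ≤
         q * (suc q ^ suc k * cutSize {r = suc q} H f)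
forest-cut {n} {q} {k} {H} {S} forest q>0 =
  let x , B≤ = averaging w (λ x → q * (K * cut (edges H) x)) _ ∑w>0 average in lookup x , B≤
  where
  open StarForest forest
  open ≤-Reasoning
  R = suc q
  K = R ^ suc k
  m = length S
  σ = surjections (suc k) R
  σ₂ = surjections k q
  w = weight {r = R} (map ends S)
  instance
    q≢0 : NonZero q
    q≢0 = >-nonZero q>0
    R^m≢0 : NonZero (R ^ m)
    R^m≢0 = m^n≢0 R m

  cut : List (Subset n) → Vec (Fin R) n → ℕ
  cut es x = length (filter (isCutEdge? (lookup x)) es)

  cut-∷ : ∀ e es x → cut (e ∷ es) x ≡ cutting e x + cut es x
  cut-∷ e es x = length-filter-∷ (isCutEdge? (lookup x)) e es

  ∑w>0 : 0 < ∑ᶜ w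
  -- Since `q ≥ 1`, there are at least two colours, so the event conditioned on has positive
  -- probability.
  ∑w>0 = n≢0⇒n>0 λ ∑w≡0 → m<n⇒n≢0 (>-nonZero⁻¹ (q ^ m * R ^ n) {{m*n≢0 _ _ {{m^n≢0 q m}} {{m^n≢0 R n}}}})
    (trans (sym (∑ᶜ-forest forest)) (trans (cong (R ^ m *_) ∑w≡0) (*-zeroʳ (R ^ m))))

  one-edge : ∀ {e} → e ∈ˡ edges H →
    q ^ m * (R ^ n * (q * σ + R * σ₂ * hits S e)) ≤ q * (R ^ m * (K * ∑ᶜ (λ x → w x * cutting e x)))
  one-edge {e} e∈H with hits-cases edges-unique e
  ... | inj₁ none = begin
    q ^ m * (R ^ n * (q * σ + R * σ₂ * hits S e))   ≡⟨ cong (λ h → q ^ m * (R ^ n * (q * σ + R * σ₂ * h))) none ⟩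
    q ^ m * (R ^ n * (q * σ + R * σ₂ * 0))          ≡⟨ lem (q ^ m) (R ^ n) q σ (R * σ₂) ⟩
    q * (q ^ m * (R ^ n * σ))                       ≤⟨ *-monoʳ-≤ q (∑ᶜ-edge-≥ forest e∈H (All.lookup (uniform H) e∈H)) ⟩
    q * (1 * (R ^ m * (K * ∑ᶜ (λ x → w x * cutting e x)))) ≡⟨ cong (q *_) (*-identityˡ _) ⟩
    q * (R ^ m * (K * ∑ᶜ (λ x → w x * cutting e x))) ∎
    where
    lem : ∀ a b q s t → a * (b * (q * s + t * 0)) ≡ q * (a * (b * s))
    lem = solve-∀
  ... | inj₂ (one , s , s∈S , refl) = begin
    q ^ m * (R ^ n * (q * σ + R * σ₂ * hits S e))   ≡⟨ cong (λ h → q ^ m * (R ^ n * (q * σ + h))) (trans (cong (R * σ₂ *_) one) (*-identityʳ _)) ⟩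
    q ^ m * (R ^ n * (q * σ + R * σ₂))
      ≤⟨ ∑ᶜ-linked-edge-≥ forest e∈H (All.lookup (uniform H) e∈H) s∈S (proj₁ (proj₂ (incident s∈S))) (proj₂ (proj₂ (incident s∈S))) ⟩
    q * (R ^ m * (K * ∑ᶜ (λ x → w x * cutting e x))) ∎

  all-edges : ∀ es → (∀ {e} → e ∈ˡ es → e ∈ˡ edges H) →
    q ^ m * (R ^ n * (q * σ * length es + R * σ₂ * ℕ-sum (map (hits S) es))) ≤
    q * (R ^ m * (K * ∑ᶜ (λ x → w x * cut es x)))
  all-edges [] _ = ≤-trans (≤-reflexive (lem (q ^ m) (R ^ n) (q * σ) (R * σ₂))) z≤n
    where
    lem : ∀ a b c d → a * (b * (c * 0 + d * 0)) ≡ 0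
    lem = solve-∀
  all-edges (e ∷ es) ⊆H = begin
    q ^ m * (R ^ n * (q * σ * suc (length es) + R * σ₂ * (hits S e + ℕ-sum (map (hits S) es))))
      ≡⟨ lem (q ^ m) (R ^ n) (q * σ) (R * σ₂) (length es) (hits S e) _ ⟩
    q ^ m * (R ^ n * (q * σ + R * σ₂ * hits S e)) +
    q ^ m * (R ^ n * (q * σ * length es + R * σ₂ * ℕ-sum (map (hits S) es)))
      ≤⟨ +-mono-≤ (one-edge (⊆H (here refl))) (all-edges es (⊆H ∘ there)) ⟩
    q * (R ^ m * (K * X)) + q * (R ^ m * (K * Y))   ≡⟨ lem₂ q (R ^ m) K X Y ⟩
    q * (R ^ m * (K * (X + Y)))                     ≡⟨ cong (λ z → q * (R ^ m * (K * z))) (∑ᶜ-distrib-+ {n = n} _ _) ⟨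
    q * (R ^ m * (K * ∑ᶜ (λ x → w x * cutting e x + w x * cut es x)))
      ≡⟨ cong (λ z → q * (R ^ m * (K * z))) (∑ᶜ-cong {n = n} λ x →
           trans (sym (*-distribˡ-+ (w x) (cutting e x) (cut es x))) (cong (w x *_) (sym (cut-∷ e es x)))) ⟩
    q * (R ^ m * (K * ∑ᶜ (λ x → w x * cut (e ∷ es) x))) ∎
    where
    X = ∑ᶜ (λ x → w x * cutting e x)
    Y = ∑ᶜ (λ x → w x * cut es x)
    lem : ∀ a b c d l h t → a * (b * (c * suc l + d * (h + t))) ≡ a * (b * (c + d * h)) + a * (b * (c * l + d * t))
    lem = solve-∀
    lem₂ : ∀ q a K X Y → q * (a * (K * X)) + q * (a * (K * Y)) ≡ q * (a * (K * (X + Y)))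
    lem₂ = solve-∀

  average : (q * σ * numEdges H + R * σ₂ * m) * ∑ᶜ w ≤ ∑ᶜ (λ x → w x * (q * (K * cut (edges H) x)))
  average = *-cancelˡ-≤ (R ^ m) (begin
    R ^ m * (B m * ∑ᶜ w)              ≡⟨ *.x∙yz≈y∙xz (R ^ m) (B m) (∑ᶜ w) ⟩
    B m * (R ^ m * ∑ᶜ w)              ≡⟨ cong (B m *_) (∑ᶜ-forest forest) ⟩
    B m * (q ^ m * R ^ n)             ≡⟨ lem₂ (B m) (q ^ m) (R ^ n) ⟩
    q ^ m * (R ^ n * B m)
      ≤⟨ *-monoʳ-≤ (q ^ m) (*-monoʳ-≤ (R ^ n) (+-monoʳ-≤ (q * σ * numEdges H)
           (*-monoʳ-≤ (R * σ₂) (length≤hits (proj₁ ∘ incident))))) ⟩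
    q ^ m * (R ^ n * B (ℕ-sum (map (hits S) (edges H)))) ≤⟨ all-edges (edges H) id ⟩
    q * (R ^ m * (K * ∑ᶜ (λ x → w x * cut (edges H) x)))    ≡⟨ lem₃ q (R ^ m) K _ ⟩
    R ^ m * (q * K * ∑ᶜ (λ x → w x * cut (edges H) x))      ≡⟨ cong (R ^ m *_) (*-distribˡ-∑ᶜ {n = n} (q * K) _) ⟩
    R ^ m * ∑ᶜ (λ x → q * K * (w x * cut (edges H) x))      ≡⟨ cong (R ^ m *_) (∑ᶜ-cong {n = n} λ x → lem₄ q K (w x) (cut (edges H) x)) ⟩
    R ^ m * ∑ᶜ (λ x → w x * (q * (K * cut (edges H) x)))    ∎)
    where
    B : ℕ → ℕ
    B t = q * σ * numEdges H + R * σ₂ * t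
    lem₂ : ∀ a b c → a * (b * c) ≡ b * (c * a)
    lem₂ = solve-∀
    lem₃ : ∀ q a K x → q * (a * (K * x)) ≡ a * (q * K * x)
    lem₃ = solve-∀
    lem₄ : ∀ q K w c → q * K * (w * c) ≡ w * (q * (K * c))
    lem₄ = solve-∀

-- Growing a star forest

∣∣-pos : ∀ {p : Subset n} {a} → a ∈ p → 1 ≤ ∣ p ∣
∣∣-pos a∈p = ≤-trans (s≤s z≤n) (≤-reflexive (∣erase∣ a∈p))

∣∣-pos⁻ : (p : Subset n) → 1 ≤ ∣ p ∣ → ∃[ a ] a ∈ p
∣∣-pos⁻ {n} p p≥1 with nonempty? p
... | yes a∈p = a∈p
... | no  ¬a  = contradiction (trans (cong ∣_∣ (Empty-unique ¬a)) (∣⊥∣≡0 n)) (m<n⇒n≢0 p≥1)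

∣∣≥2 : ∀ {p : Subset n} {a b} → a ≢ b → a ∈ p → b ∈ p → 2 ≤ ∣ p ∣
∣∣≥2 a≢b a∈p b∈p = ≤-trans (s≤s (∣∣-pos (∈-erase⁺ (≢-sym a≢b) b∈p))) (≤-reflexive (∣erase∣ a∈p))

∣∣≥2⁻ : (p : Subset n) → 2 ≤ ∣ p ∣ → ∃[ a ] ∃[ b ] (a ≢ b × a ∈ p × b ∈ p)
∣∣≥2⁻ p p≥2 =
  let a , a∈p = ∣∣-pos⁻ p (≤-trans (s≤s z≤n) p≥2)
      b , b∈  = ∣∣-pos⁻ (erase p a) (s≤s⁻¹ (≤-trans p≥2 (≤-reflexive (sym (∣erase∣ a∈p)))))
      b≢a , b∈p = ∈-erase⁻ b∈
  in a , b , ≢-sym b≢a , a∈p , b∈p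

another-member : (p : Subset n) → 2 ≤ ∣ p ∣ → ∀ a → ∃[ b ] (b ≢ a × b ∈ p)
another-member p p≥2 a with ∣∣≥2⁻ p p≥2
... | b , b′ , b≢b′ , b∈p , b′∈p with b Fin.≟ a
...   | yes refl = b′ , ≢-sym b≢b′ , b′∈p
...   | no  b≢a  = b , b≢a , b∈p

∣p∩q∣+∣p∩∁q∣ : (p q : Subset n) → ∣ p ∩ q ∣ + ∣ p ∩ ∁ q ∣ ≡ ∣ p ∣
∣p∩q∣+∣p∩∁q∣ []            []            = refl
∣p∩q∣+∣p∩∁q∣ (outside ∷ p) (_ ∷ q)       = ∣p∩q∣+∣p∩∁q∣ p q
∣p∩q∣+∣p∩∁q∣ (inside ∷ p)  (inside ∷ q)  = cong suc (∣p∩q∣+∣p∩∁q∣ p q)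
∣p∩q∣+∣p∩∁q∣ (inside ∷ p)  (outside ∷ q) = trans (+-suc _ _) (cong suc (∣p∩q∣+∣p∩∁q∣ p q))

∣∁p∩q∣+∣∁[p∪q]∣ : (p q : Subset n) → ∣ ∁ p ∩ q ∣ + ∣ ∁ (p ∪ q) ∣ ≡ ∣ ∁ p ∣
∣∁p∩q∣+∣∁[p∪q]∣ []            []            = refl
∣∁p∩q∣+∣∁[p∪q]∣ (inside ∷ p)  (_ ∷ q)       = ∣∁p∩q∣+∣∁[p∪q]∣ p q
∣∁p∩q∣+∣∁[p∪q]∣ (outside ∷ p) (inside ∷ q)  = cong suc (∣∁p∩q∣+∣∁[p∪q]∣ p q)
∣∁p∩q∣+∣∁[p∪q]∣ (outside ∷ p) (outside ∷ q) = trans (+-suc _ _) (cong suc (∣∁p∩q∣+∣∁[p∪q]∣ p q))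

∣s∩p∣+∣s∩[∁p∩q]∣ : (s p q : Subset n) → ∣ s ∩ p ∣ + ∣ s ∩ (∁ p ∩ q) ∣ ≡ ∣ s ∩ (p ∪ q) ∣
∣s∩p∣+∣s∩[∁p∩q]∣ []            []            []            = refl
∣s∩p∣+∣s∩[∁p∩q]∣ (outside ∷ s) (_ ∷ p)       (_ ∷ q)       = ∣s∩p∣+∣s∩[∁p∩q]∣ s p q
∣s∩p∣+∣s∩[∁p∩q]∣ (inside ∷ s)  (inside ∷ p)  (_ ∷ q)       = cong suc (∣s∩p∣+∣s∩[∁p∩q]∣ s p q)
∣s∩p∣+∣s∩[∁p∩q]∣ (inside ∷ s)  (outside ∷ p) (inside ∷ q)  = trans (+-suc _ _) (cong suc (∣s∩p∣+∣s∩[∁p∩q]∣ s p q))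
∣s∩p∣+∣s∩[∁p∩q]∣ (inside ∷ s)  (outside ∷ p) (outside ∷ q) = ∣s∩p∣+∣s∩[∁p∩q]∣ s p q

∣insert∣≤ : (p : Subset n) (a : Fin n) → ∣ insert p a ∣ ≤ suc ∣ p ∣
∣insert∣≤ (inside  ∷ p) zero    = n≤1+n _
∣insert∣≤ (outside ∷ p) zero    = ≤-refl
∣insert∣≤ (inside  ∷ p) (suc a) = s≤s (∣insert∣≤ p a)
∣insert∣≤ (outside ∷ p) (suc a) = ∣insert∣≤ p a

members : Subset n → List (Fin n)
members []            = []
members (inside  ∷ p) = zero ∷ map suc (members p)
members (outside ∷ p) = map suc (members p)

length-members : (p : Subset n) → length (members p) ≡ ∣ p ∣
length-members []            = refl
length-members (inside  ∷ p) = cong suc (trans (length-map suc (members p)) (length-members p))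
length-members (outside ∷ p) = trans (length-map suc (members p)) (length-members p)

∈-members⁻ : ∀ {p : Subset n} {a} → a ∈ˡ members p → a ∈ p
∈-members⁻ {p = inside ∷ p} (here refl) = here
∈-members⁻ {p = inside ∷ p} (there a∈) with ∈-map⁻ suc a∈
... | _ , b∈ , refl = there (∈-members⁻ b∈)
∈-members⁻ {p = outside ∷ p} a∈ with ∈-map⁻ suc a∈
... | _ , b∈ , refl = there (∈-members⁻ b∈)

members-unique : (p : Subset n) → AllPairs _≢_ (members p)
members-unique []            = []
members-unique (inside  ∷ p) = All.map⁺ (All.universal (λ _ ()) _) ∷ Unique.map⁺ Fin.suc-injective (members-unique p)
members-unique (outside ∷ p) = Unique.map⁺ Fin.suc-injective (members-unique p)

centres : List (Link n) → Subset n
centres []      = ⊥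
centres (s ∷ S) = insert (centres S) (centre s)

centre∈centres : ∀ {S : List (Link n)} {s} → s ∈ˡ S → centre s ∈ centres S
centre∈centres {S = s ∷ S} (here refl) = ∈-insert (centres S) (centre s)
centre∈centres {S = t ∷ S} (there s∈)  = ∈-insert⁺ (centres S) (centre t) (centre∈centres s∈)

∣centres∣≤ : (S : List (Link n)) → ∣ centres S ∣ ≤ length S
∣centres∣≤ {n} []  = ≤-reflexive (∣⊥∣≡0 n)
∣centres∣≤ (s ∷ S) = ≤-trans (∣insert∣≤ (centres S) (centre s)) (s≤s (∣centres∣≤ S))

module _ {k} (k≥2 : 2 ≤ k) (H : Hypergraph k n) (covered : NoIsolatedVertices H) where

  private
    ∣edge∣ : ∀ {e} → e ∈ˡ edges H → ∣ e ∣ ≡ k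
    ∣edge∣ = All.lookup (uniform H)

  -- The second summand of count pays for the edges e with |e \ C| ≥ 2 that get no link of their
  -- own: all but one of the vertices of e \ C are centres, so |e \ C| is at most twice their number.
  record Grown (C : Subset n) : Set where
    field
      links    : List (Link n)
      forest   : StarForest H links
      leaves∉C : ∀ {s} → s ∈ˡ links → leaf s ∉ C
      count    : ∣ ∁ C ∣ + 2 * ∣ centres links ∩ C ∣ ≤ (k ⊔ 3) * length links

  -- Every vertex outside `C` is hung on another vertex of some edge containing it, and saturation
  -- forces that neighbour into `C`. Saturation also says that an edge contains at most one leaf,
  -- which makes the chosen edges distinct and the leaves separated.
  grown-saturated : ∀ C → (∀ {e a b} → e ∈ˡ edges H → a ∉ C → b ∉ C → a ∈ e → b ∈ e → a ≡ b) → Grown C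
  grown-saturated C saturated = record
    { links    = S
    ; forest   = record
      { leaves-unique = AllPairs.map⁺ (members-unique (∁ C))
      ; edges-unique  = AllPairs.map⁺ (AllPairs-mapWith∈
          (λ a∈ b∈ a≢b e≡ → a≢b (saturated (e∈H _) (outer a∈) (outer b∈) (a∈e _) (subst (_ ∈_) (sym e≡) (a∈e _))))
          (members-unique (∁ C)))
      ; leaf≢centre   = λ s∈ t∈ l≡c → leaves∉C s∈ (subst (_∈ C) (sym l≡c) (centres∈C t∈))
      ; incident      = λ s∈ → incident s∈
      ; separated     = λ s∈ t∈ e∈ ls∈e lt∈e _ → saturated e∈ (leaves∉C s∈) (leaves∉C t∈) ls∈e lt∈e
      }
    ; leaves∉C = leaves∉C
    ; count    = begin
        -- There are as many links as vertices outside `C` and at most that many centres, each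
        -- counted twice. This is where the 3 in `k ⊔ 3` comes from.
        ∣ ∁ C ∣ + 2 * ∣ centres S ∩ C ∣   ≤⟨ +-mono-≤ (≤-reflexive (sym ∣S∣)) (*-monoʳ-≤ 2 (≤-trans (∣p∩q∣≤∣p∣ (centres S) C) (∣centres∣≤ S))) ⟩
        3 * length S                      ≤⟨ *-monoˡ-≤ (length S) (m≤n⊔m k 3) ⟩
        (k ⊔ 3) * length S                ∎
    }
    where
    open ≤-Reasoning
    find-edge : ∀ a → ∃[ e ] (e ∈ˡ edges H × a ∈ e)
    find-edge a = find (covered a)
    e∈H : ∀ a → proj₁ (find-edge a) ∈ˡ edges H
    e∈H a = proj₁ (proj₂ (find-edge a))
    a∈e : ∀ a → a ∈ proj₁ (find-edge a)
    a∈e a = proj₂ (proj₂ (find-edge a))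
    neighbour : ∀ a → ∃[ b ] (b ≢ a × b ∈ proj₁ (find-edge a))
    neighbour a = another-member _ (≤-trans k≥2 (≤-reflexive (sym (∣edge∣ (e∈H a))))) a
    hang : Fin n → Link n
    hang a = link a (proj₁ (neighbour a)) (proj₁ (find-edge a))
    S = map hang (members (∁ C))
    ∣S∣ : length S ≡ ∣ ∁ C ∣
    ∣S∣ = trans (length-map hang (members (∁ C))) (length-members (∁ C))
    outer : ∀ {a} → a ∈ˡ members (∁ C) → a ∉ C
    outer a∈ = x∈∁p⇒x∉p (∈-members⁻ a∈)
    on-links : {P : Link n → Set} → (∀ {a} → a ∈ˡ members (∁ C) → P (hang a)) → ∀ {s} → s ∈ˡ S → P s
    on-links f = All.lookup (All.map⁺ (All.tabulate f))
    leaves∉C : ∀ {s} → s ∈ˡ S → leaf s ∉ C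
    leaves∉C = on-links outer
    neighbour∈C : ∀ {a} → a ∉ C → proj₁ (neighbour a) ∈ C
    neighbour∈C {a} a∉C = let b , b≢a , b∈e = neighbour a in
      decidable-stable (b ∈? C) λ b∉C → b≢a (saturated (e∈H a) b∉C a∉C b∈e (a∈e a))
    centres∈C : ∀ {s} → s ∈ˡ S → centre s ∈ C
    centres∈C = on-links (neighbour∈C ∘ outer)
    incident : ∀ {s} → s ∈ˡ S → edge s ∈ˡ edges H × leaf s ∈ edge s × centre s ∈ edge s
    incident = on-links λ {a} _ → e∈H a , a∈e a , proj₂ (proj₂ (neighbour a))

  -- The leaves of the forest grown from `C ∪ e` avoid `e`, so `e` is not yet recorded by a link and
  -- no vertex of `e` is a leaf. Two new vertices of `e` that are not centres can thus form a star
  -- of their own; failing that, the centres among the new vertices pay for `e`.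
  grown-step : ∀ {C e} → e ∈ˡ edges H → 2 ≤ ∣ ∁ C ∩ e ∣ → Grown (C ∪ e) → Grown C
  grown-step {C} {e} e∈H N≥2 G with 2 ≤? ∣ (∁ C ∩ e) ∩ ∁ (centres (Grown.links G)) ∣
  ... | no few = record
    { links    = S
    ; forest   = forest
    ; leaves∉C = λ s∈ l∈C → leaves∉C s∈ (p⊆p∪q e l∈C)
    ; count    = begin
        ∣ ∁ C ∣ + 2 * ∣ X ∩ C ∣                  ≡⟨ cong (_+ 2 * ∣ X ∩ C ∣) (∣∁p∩q∣+∣∁[p∪q]∣ C e) ⟨
        ∣ N ∣ + ∣ ∁ (C ∪ e) ∣ + 2 * ∣ X ∩ C ∣    ≤⟨ +-monoˡ-≤ (2 * ∣ X ∩ C ∣) (+-monoˡ-≤ (∣ ∁ (C ∪ e) ∣) N≤) ⟩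
        2 * ∣ X ∩ N ∣ + ∣ ∁ (C ∪ e) ∣ + 2 * ∣ X ∩ C ∣    ≡⟨ lem (∣ X ∩ N ∣) (∣ ∁ (C ∪ e) ∣) (∣ X ∩ C ∣) ⟩
        ∣ ∁ (C ∪ e) ∣ + 2 * (∣ X ∩ C ∣ + ∣ X ∩ N ∣)      ≡⟨ cong (λ z → ∣ ∁ (C ∪ e) ∣ + 2 * z) (∣s∩p∣+∣s∩[∁p∩q]∣ X C e) ⟩
        ∣ ∁ (C ∪ e) ∣ + 2 * ∣ X ∩ (C ∪ e) ∣      ≤⟨ count ⟩
        (k ⊔ 3) * length S                       ∎
    }
    where
    open Grown G renaming (links to S)
    open ≤-Reasoning
    X = centres S
    N = ∁ C ∩ e
    lem : ∀ a b c → 2 * a + b + 2 * c ≡ b + 2 * (c + a)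
    lem = solve-∀
    N≤1+ : ∣ N ∣ ≤ suc (∣ X ∩ N ∣)
    N≤1+ = begin
      ∣ N ∣                       ≡⟨ ∣p∩q∣+∣p∩∁q∣ N X ⟨
      ∣ N ∩ X ∣ + ∣ N ∩ ∁ X ∣     ≤⟨ +-mono-≤ (≤-reflexive (cong ∣_∣ (∩-comm N X))) (s≤s⁻¹ (≰⇒> few)) ⟩
      ∣ X ∩ N ∣ + 1               ≡⟨ +-comm (∣ X ∩ N ∣) 1 ⟩
      suc (∣ X ∩ N ∣)             ∎
    N≤ : ∣ N ∣ ≤ 2 * ∣ X ∩ N ∣
    N≤ = begin
      ∣ N ∣                       ≤⟨ N≤1+ ⟩
      -- As `N` has two elements and at most one is not a centre, `X ∩ N` is nonempty and absorbs
      -- the 1.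
      1 + ∣ X ∩ N ∣               ≤⟨ +-monoˡ-≤ (∣ X ∩ N ∣) (s≤s⁻¹ (≤-trans N≥2 N≤1+)) ⟩
      ∣ X ∩ N ∣ + ∣ X ∩ N ∣       ≡⟨ cong (∣ X ∩ N ∣ +_) (+-identityʳ (∣ X ∩ N ∣)) ⟨
      2 * ∣ X ∩ N ∣               ∎
  ... | yes many with ∣∣≥2⁻ ((∁ C ∩ e) ∩ ∁ (centres (Grown.links G))) many
  ...   | a , b , a≢b , a∈ , b∈ = record
    { links    = link a b e ∷ S
    ; forest   = record
      { leaves-unique = All.tabulate (λ s∈ a≡ → leaves∉C s∈ (subst (_∈ C ∪ e) a≡ (∈C∪e a∈))) ∷ leaves-unique
      ; edges-unique  = All.tabulate (λ s∈ e≡ → leaves∉C s∈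
                          (q⊆p∪q C e (subst (_ ∈_) (sym e≡) (proj₁ (proj₂ (incident s∈)))))) ∷ edges-unique
      ; leaf≢centre   = λ where
          (here refl) (here refl) → a≢b
          (here refl) (there t∈)  → λ { refl → ∉X a∈ (centre∈centres t∈) }
          (there s∈)  (here refl) → λ { refl → leaves∉C s∈ (∈C∪e b∈) }
          (there s∈)  (there t∈)  → leaf≢centre s∈ t∈
      ; incident      = λ where
          (here refl) → e∈H , ∈e a∈ , ∈e b∈
          (there s∈)  → incident s∈
      ; separated     = λ where
          (here refl) (here refl) _ _ _ _ → refl
          (here refl) (there t∈)  _ _ _ c≡ → contradiction (subst (_∈ X) (sym c≡) (centre∈centres t∈)) (∉X b∈)
          (there s∈)  (here refl) _ _ _ c≡ → contradiction (subst (_∈ X) c≡ (centre∈centres s∈)) (∉X b∈)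
          (there s∈)  (there t∈)  → separated s∈ t∈
      }
    ; leaves∉C = λ where
        (here refl) → ∉C a∈
        (there s∈) l∈C → leaves∉C s∈ (p⊆p∪q e l∈C)
    ; count    = begin
        ∣ ∁ C ∣ + 2 * ∣ insert X b ∩ C ∣         ≡⟨ cong (_+ 2 * ∣ insert X b ∩ C ∣) (∣∁p∩q∣+∣∁[p∪q]∣ C e) ⟨
        ∣ N ∣ + ∣ ∁ (C ∪ e) ∣ + 2 * ∣ insert X b ∩ C ∣
          -- The new link pays for the at most `k` vertices of `N`; its centre `b` lies outside `C`,
          -- so no further centre has to be counted in `C`.
          ≤⟨ +-mono-≤ (+-monoˡ-≤ (∣ ∁ (C ∪ e) ∣) N≤k) (*-monoʳ-≤ 2 (p⊆q⇒∣p∣≤∣q∣ X∩C⊆)) ⟩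
        k + ∣ ∁ (C ∪ e) ∣ + 2 * ∣ X ∩ (C ∪ e) ∣  ≡⟨ +-assoc k _ _ ⟩
        k + (∣ ∁ (C ∪ e) ∣ + 2 * ∣ X ∩ (C ∪ e) ∣) ≤⟨ +-mono-≤ (m≤m⊔n k 3) count ⟩
        (k ⊔ 3) + (k ⊔ 3) * length S             ≡⟨ *-suc (k ⊔ 3) (length S) ⟨
        (k ⊔ 3) * suc (length S)                 ∎
    }
    where
    open Grown G renaming (links to S)
    open StarForest forest
    open ≤-Reasoning
    X = centres S
    N = ∁ C ∩ e
    ∈N : ∀ {v} → v ∈ N ∩ ∁ X → v ∈ ∁ C × v ∈ e
    ∈N v∈ = x∈p∩q⁻ (∁ C) e (proj₁ (x∈p∩q⁻ N (∁ X) v∈))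
    ∈e : ∀ {v} → v ∈ N ∩ ∁ X → v ∈ e
    ∈e v∈ = proj₂ (∈N v∈)
    ∉C : ∀ {v} → v ∈ N ∩ ∁ X → v ∉ C
    ∉C v∈ = x∈∁p⇒x∉p (proj₁ (∈N v∈))
    ∈C∪e : ∀ {v} → v ∈ N ∩ ∁ X → v ∈ C ∪ e
    ∈C∪e v∈ = q⊆p∪q C e (∈e v∈)
    ∉X : ∀ {v} → v ∈ N ∩ ∁ X → v ∉ X
    ∉X v∈ = x∈∁p⇒x∉p (proj₂ (x∈p∩q⁻ N (∁ X) v∈))
    N≤k : ∣ N ∣ ≤ k
    N≤k = ≤-trans (∣p∩q∣≤∣q∣ (∁ C) e) (≤-reflexive (∣edge∣ e∈H))
    X∩C⊆ : ∀ {v} → v ∈ insert X b ∩ C → v ∈ X ∩ (C ∪ e)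
    X∩C⊆ v∈ with x∈p∩q⁻ (insert X b) C v∈
    ... | v∈′ , v∈C with ∈-insert⁻ X b v∈′
    ...   | inj₁ refl = contradiction v∈C (∉C b∈)
    ...   | inj₂ v∈X  = x∈p∩q⁺ (v∈X , p⊆p∪q e v∈C)

  -- An edge with two vertices outside `C` strictly shrinks the complement when added to `C`;
  -- without such an edge, `C` is saturated.
  grow : ∀ C → Acc _<_ (∣ ∁ C ∣) → Grown C
  grow C (acc rec) with any? (λ e → 2 ≤? ∣ ∁ C ∩ e ∣) (edges H)
  ... | yes found = let e , e∈H , N≥2 = find found in
    grown-step e∈H N≥2 (grow (C ∪ e) (rec (≤-trans
      (+-monoˡ-≤ (∣ ∁ (C ∪ e) ∣) (≤-trans (s≤s z≤n) N≥2)) (≤-reflexive (∣∁p∩q∣+∣∁[p∪q]∣ C e)))))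
  ... | no  none  = grown-saturated C λ {e} {a} {b} e∈H a∉C b∉C a∈e b∈e →
    decidable-stable (a Fin.≟ b) λ a≢b →
      none (lose e∈H (∣∣≥2 a≢b (x∈p∩q⁺ (x∉p⇒x∈∁p a∉C , a∈e)) (x∈p∩q⁺ (x∉p⇒x∈∁p b∉C , b∈e))))

  large-star-forest : ∃[ S ] (StarForest H S × n ≤ (k ⊔ 3) * length S)
  large-star-forest = links , forest , (begin
    n                                    ≡⟨ cong (n ∸_) (∣⊥∣≡0 n) ⟨
    n ∸ ∣ ⊥ {n} ∣                        ≡⟨ ∣∁p∣≡n∸∣p∣ (⊥ {n}) ⟨
    ∣ ∁ (⊥ {n}) ∣                        ≤⟨ m≤m+n _ _ ⟩
    ∣ ∁ (⊥ {n}) ∣ + 2 * ∣ centres links ∩ ⊥ ∣ ≤⟨ count ⟩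
    (k ⊔ 3) * length links               ∎)
    where
    open ≤-Reasoning
    open Grown (grow ⊥ (<-wellFounded _))

-- Perfect matchings

sum-∈? : (e : Subset n) → sum (λ v → 𝟙 (v ∈? e)) ≡ ∣ e ∣
sum-∈? [] = refl
sum-∈? (s ∷ e) with s
... | inside  = cong suc (trans (∑.sum-cong-≗ λ v → 𝟙-cong (suc v ∈? (inside ∷ e)) (v ∈? e) drop-there there) (sum-∈? e))
... | outside = trans (∑.sum-cong-≗ λ v → 𝟙-cong (suc v ∈? (outside ∷ e)) (v ∈? e) drop-there there) (sum-∈? e)

-- Double counting of the incidences between vertices and edges.
sum-degrees : ∀ {k} (es : List (Subset n)) → All (λ e → ∣ e ∣ ≡ k) es →
              sum (λ v → length (filter (v ∈?_) es)) ≡ length es * k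
sum-degrees {n} [] [] = trans (sum-const n) (*-zeroʳ n)
sum-degrees {n} {k} (e ∷ es) (∣e∣≡k ∷ uniform) = begin
  sum (λ v → length (filter (v ∈?_) (e ∷ es)))                  ≡⟨ ∑.sum-cong-≗ (λ v → length-filter-∷ (v ∈?_) e es) ⟩
  sum (λ v → 𝟙 (v ∈? e) + length (filter (v ∈?_) es))           ≡⟨ ∑.∑-distrib-+ (λ v → 𝟙 (v ∈? e)) (λ v → length (filter (v ∈?_) es)) ⟩
  sum (λ v → 𝟙 (v ∈? e)) + sum (λ v → length (filter (v ∈?_) es)) ≡⟨ cong₂ _+_ (trans (sum-∈? e) ∣e∣≡k) (sum-degrees es uniform) ⟩
  k + length es * k                                             ∎
  where open ≡-Reasoning

matching-order : ∀ {k} {H : Hypergraph k n} → IsPerfectMatching H → n ≡ numEdges H * k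
matching-order {n} {k} {H} matching = begin
  n                                             ≡⟨ *-identityʳ n ⟨
  n * 1                                         ≡⟨ sum-const n ⟨
  sum {n} (λ _ → 1)                             ≡⟨ ∑.sum-cong-≗ (λ v → sym (matching v)) ⟩
  sum (λ v → length (filter (v ∈?_) (edges H))) ≡⟨ sum-degrees (edges H) (uniform H) ⟩
  numEdges H * k                                ∎
  where open ≡-Reasoning

matching-covers : ∀ {k} {H : Hypergraph k n} → IsPerfectMatching H → NoIsolatedVertices H
matching-covers {H = H} matching v = nonempty (matching v) (λ e∈ → ∈-filter⁻ (v ∈?_) e∈)
  where
  nonempty : ∀ {es} → length es ≡ 1 → (∀ {e} → e ∈ˡ es → e ∈ˡ edges H × v ∈ e) → Any (v ∈_) (edges H)
  nonempty {e ∷ _} _ f = let e∈H , v∈e = f (here refl) in lose e∈H v∈e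

-- Surjections onto one or two colours

surjections-1 : ∀ k → surjections (suc k) 1 ≡ 1
surjections-1 zero    = refl
surjections-1 (suc k) = trans (surjections-suc (suc k) 0)
  (trans (+-identityʳ _) (trans (+-identityʳ _) (surjections-1 k)))

-- Of all colourings with two colours, exactly the two constant ones fail to be surjective.
surjections-2 : ∀ k → surjections (suc k) 2 + 2 ≡ 2 ^ suc k
surjections-2 zero    = refl
surjections-2 (suc k) = begin
  surjections (2 + k) 2 + 2                                   ≡⟨ cong (_+ 2) (surjections-suc (suc k) 1) ⟩
  2 * (surjections (suc k) 2 + surjections (suc k) 1) + 2     ≡⟨ cong (λ z → 2 * (surjections (suc k) 2 + z) + 2) (surjections-1 k) ⟩
  2 * (surjections (suc k) 2 + 1) + 2                         ≡⟨ lem (surjections (suc k) 2) ⟩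
  2 * (surjections (suc k) 2 + 2)                             ≡⟨ cong (2 *_) (surjections-2 k) ⟩
  2 ^ (2 + k)                                                 ∎
  where
  open ≡-Reasoning
  lem : ∀ s → 2 * (s + 1) + 2 ≡ 2 * (s + 2)
  lem = solve-∀

-- From natural to rational numbers

/-homo : ∀ a b .{{_ : NonZero b}} → toℚᵘ (ℤ.+ a / b) ℚᵘ.≃ (ℤ.+ a ℚᵘ./ b)
/-homo a (suc b) = toℚᵘ-fromℚᵘ (mkℚᵘ (ℤ.+ a) b)

/-≤ : ∀ {a b c d} .{{_ : NonZero b}} .{{_ : NonZero d}} → a * d ≤ c * b → ℤ.+ a ℚᵘ./ b ℚᵘ.≤ ℤ.+ c ℚᵘ./ d
/-≤ {a} {suc b} {c} {suc d} le = ℚᵘ.*≤* (subst₂ ℤ._≤_ (ℤ.pos-* a (suc d)) (ℤ.pos-* c (suc b)) (ℤ.+≤+ le))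

/-+ : ∀ a b c d .{{_ : NonZero b}} .{{_ : NonZero d}} →
      (ℤ.+ a ℚᵘ./ b) ℚᵘ.+ (ℤ.+ c ℚᵘ./ d) ℚᵘ.≃ (ℚᵘ._/_ (ℤ.+ (a * d + c * b)) (b * d) {{m*n≢0 b d}})
/-+ a (suc b) c (suc d) = ℚᵘ.*≡* (cong (ℤ._* ℤ.+ (suc b * suc d))
  (trans (cong₂ ℤ._+_ (sym (ℤ.pos-* a (suc d))) (sym (ℤ.pos-* c (suc b)))) (sym (ℤ.pos-+ (a * suc d) (c * suc b)))))

/-*-ℕ→ℚ : ∀ a b m .{{_ : NonZero b}} → toℚᵘ ((ℤ.+ a / b) *ℚ ℕ→ℚ m) ℚᵘ.≃ (ℤ.+ (a * m) ℚᵘ./ b)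
/-*-ℕ→ℚ a b@(suc _) m = begin
  toℚᵘ ((ℤ.+ a / b) *ℚ ℕ→ℚ m)                     ≈⟨ toℚᵘ-homo-* (ℤ.+ a / b) (ℕ→ℚ m) ⟩
  toℚᵘ (ℤ.+ a / b) ℚᵘ.* toℚᵘ (ℕ→ℚ m)              ≈⟨ ℚᵘ.*-cong (/-homo a b) (/-homo m 1) ⟩
  (ℤ.+ a ℚᵘ./ b) ℚᵘ.* (ℤ.+ m ℚᵘ./ 1)                ≈⟨ ℚᵘ.*≡* (cong₂ ℤ._*_ (sym (ℤ.pos-* a m)) (cong ℤ.+_ (sym (*-identityʳ b)))) ⟩
  ℤ.+ (a * m) ℚᵘ./ b                              ∎
  where open ≈-Reasoning ℚᵘ.≃-setoid

/-+-*-ℕ→ℚ : ∀ a b p q m .{{_ : NonZero b}} .{{_ : NonZero q}} →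
  toℚᵘ (ℤ.+ a / b ℚ.+ (ℤ.+ p / q) *ℚ ℕ→ℚ m) ℚᵘ.≃ (ℚᵘ._/_ (ℤ.+ (a * q + p * m * b)) (b * q) {{m*n≢0 b q}})
/-+-*-ℕ→ℚ a b p q m = begin
  toℚᵘ (ℤ.+ a / b ℚ.+ (ℤ.+ p / q) *ℚ ℕ→ℚ m)               ≈⟨ toℚᵘ-homo-+ (ℤ.+ a / b) ((ℤ.+ p / q) *ℚ ℕ→ℚ m) ⟩
  toℚᵘ (ℤ.+ a / b) ℚᵘ.+ toℚᵘ ((ℤ.+ p / q) *ℚ ℕ→ℚ m)       ≈⟨ ℚᵘ.+-cong (/-homo a b) (/-*-ℕ→ℚ p q m) ⟩
  (ℤ.+ a ℚᵘ./ b) ℚᵘ.+ (ℤ.+ (p * m) ℚᵘ./ q)                ≈⟨ /-+ a b (p * m) q ⟩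
  ℚᵘ._/_ (ℤ.+ (a * q + p * m * b)) (b * q) {{m*n≢0 b q}} ∎
  where open ≈-Reasoning ℚᵘ.≃-setoid

x+y-y≡x : ∀ x y → x ℚ.+ y ℚ.- y ≡ x
x+y-y≡x x y = trans (ℚ.+-assoc x y (ℚ.- y)) (trans (cong (x ℚ.+_) (ℚ.+-inverseʳ y)) (ℚ.+-identityʳ x))

-- The hypothesis is the conclusion with `(p / q) * m` moved to the left and all denominators
-- cleared. The comparison takes place in the unnormalised rationals, where the order is
-- cross-multiplication.
≤-excess : ∀ a b p q m s .{{_ : NonZero b}} .{{_ : NonZero q}} →
  a * q + p * m * b ≤ s * (b * q) → ℤ.+ a / b ≤ℚ ℕ→ℚ s ℚ.- (ℤ.+ p / q) *ℚ ℕ→ℚ m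
≤-excess a b p q m s le = subst (_≤ℚ ℕ→ℚ s ℚ.- y) (x+y-y≡x (ℤ.+ a / b) y) (ℚ.+-monoˡ-≤ (ℚ.- y) (toℚᵘ-cancel-≤ (begin
  toℚᵘ (ℤ.+ a / b ℚ.+ y)        ≃⟨ /-+-*-ℕ→ℚ a b p q m ⟩
  ℚᵘ._/_ (ℤ.+ (a * q + p * m * b)) (b * q) {{m*n≢0 b q}}
    ≤⟨ /-≤ {b = b * q} {d = 1} {{m*n≢0 b q}} (≤-trans (≤-reflexive (*-identityʳ _)) le) ⟩
  ℤ.+ s ℚᵘ./ 1                  ≃⟨ /-homo s 1 ⟨
  toℚᵘ (ℕ→ℚ s)                ∎)))
  where
  open ℚᵘ.≤-Reasoning
  y = (ℤ.+ p / q) *ℚ ℕ→ℚ m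

excess-≤ : ∀ a b p q m s .{{_ : NonZero b}} .{{_ : NonZero q}} →
  s * (b * q) ≤ a * q + p * m * b → ℕ→ℚ s ℚ.- (ℤ.+ p / q) *ℚ ℕ→ℚ m ≤ℚ ℤ.+ a / b
excess-≤ a b p q m s le = subst (ℕ→ℚ s ℚ.- y ≤ℚ_) (x+y-y≡x (ℤ.+ a / b) y) (ℚ.+-monoˡ-≤ (ℚ.- y) (toℚᵘ-cancel-≤ (begin
  toℚᵘ (ℕ→ℚ s)                ≃⟨ /-homo s 1 ⟩
  ℤ.+ s ℚᵘ./ 1
    ≤⟨ /-≤ {b = 1} {d = b * q} {{_}} {{m*n≢0 b q}} (≤-trans le (≤-reflexive (sym (*-identityʳ _)))) ⟩
  ℚᵘ._/_ (ℤ.+ (a * q + p * m * b)) (b * q) {{m*n≢0 b q}} ≃⟨ /-+-*-ℕ→ℚ a b p q m ⟨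
  toℚᵘ (ℤ.+ a / b ℚ.+ y)        ∎)))
  where
  open ℚᵘ.≤-Reasoning
  y = (ℤ.+ p / q) *ℚ ℕ→ℚ m

-- Cuts with large excess

-- Combines `forest-cut` with `n ≤ (suc k ⊔ 3) * length S`; the factor `suc k ⊔ 3` on the other
-- terms replaces a division.
large-cut : ∀ {k} → 1 ≤ q → 1 ≤ k → (H : Hypergraph (suc k) n) → NoIsolatedVertices H →
  ∃[ f ] suc q * surjections k q * n + q * surjections (suc k) (suc q) * numEdges H * (suc k ⊔ 3) ≤
         q * (suc q ^ suc k * cutSize {r = suc q} H f) * (suc k ⊔ 3)
large-cut {q} {n} {k} q≥1 k≥1 H covered =
  let S , forest , n≤ = large-star-forest (s≤s k≥1) H covered
      f , cut≥ = forest-cut forest q≥1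
  in f , (begin
    τ * n + σ * K                                       ≤⟨ +-monoˡ-≤ (σ * K) (*-monoʳ-≤ τ n≤) ⟩
    τ * (K * length S) + σ * K                          ≡⟨ lem τ K (length S) σ ⟩
    (σ + τ * length S) * K                              ≤⟨ *-monoˡ-≤ K cut≥ ⟩
    q * (suc q ^ suc k * cutSize H f) * K               ∎)
  where
  open ≤-Reasoning
  K = suc k ⊔ 3
  τ = suc q * surjections k q
  σ = q * surjections (suc k) (suc q) * numEdges H
  lem : ∀ t K l s → t * (K * l) + s * K ≡ (s + t * l) * K
  lem = solve-∀

linear-excess : ∀ {k} → 1 ≤ q → q ≤ k → ∃[ c ] (0ℚ <ℚ c ×
  ((n : ℕ) (H : Hypergraph (suc k) n) → NoIsolatedVertices H →
    ∃[ f ] (c *ℚ ℕ→ℚ n ≤ℚ excess {suc k} {n} {suc q} H f)))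
linear-excess {q@(suc q′)} {k@(suc k′)} q≥1 (s≤s q′≤k′) = ℤ.+ 1 / b , ℚ.positive⁻¹ (ℤ.+ 1 / b) {{ℚ.normalize-pos 1 b}} , λ n H covered →
  let f , cut≥ = large-cut q≥1 (s≤s z≤n) H covered
      m = numEdges H
      s = cutSize H f
  in f , subst (_≤ℚ excess H f) (sym (scale n)) (≤-excess n b σ P m s (begin
    n * P + σ * m * b                     ≡⟨ lem n P σ m q K ⟩
    -- The gain `τ` is positive because `q ≤ k` makes the Stirling number nonzero. Weakening `τ` to
    -- 1 gives the simple constant `c = 1 / b`.
    (n + q * σ * m * K) * P               ≤⟨ *-monoˡ-≤ P (+-monoˡ-≤ (q * σ * m * K) (m≤n*m n τ)) ⟩
    (τ * n + q * σ * m * K) * P           ≤⟨ *-monoˡ-≤ P cut≥ ⟩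
    q * (P * s) * K * P                   ≡⟨ lem₂ q P s K ⟩
    s * (b * P)                           ∎))
  where
  open ≤-Reasoning
  K = suc k ⊔ 3
  P = suc q ^ suc k
  σ = surjections (suc k) (suc q)
  τ = suc q * surjections k q
  b = q * P * K
  instance
    P≢0 : NonZero P
    P≢0 = m^n≢0 (suc q) (suc k)
    b≢0 : NonZero b
    b≢0 = m*n≢0 (q * P) K {{m*n≢0 q P}}
    τ≢0 : NonZero τ
    τ≢0 = m*n≢0 (suc q) _ {{_}} {{m*n≢0 (stirling2 k q) (q !) {{>-nonZero (stirling2-pos q′≤k′)}} {{q !≢0}}}}
  scale : ∀ n → (ℤ.+ 1 / b) *ℚ ℕ→ℚ n ≡ ℤ.+ n / b
  scale n = ℚ.toℚᵘ-injective (ℚᵘ.≃-trans (/-*-ℕ→ℚ 1 b n)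
    (ℚᵘ.≃-trans (ℚᵘ.≃-reflexive (cong (λ z → ℤ.+ z ℚᵘ./ b) (*-identityˡ n))) (ℚᵘ.≃-sym (/-homo n b))))
  lem : ∀ n P σ m q K → n * P + σ * m * (q * P * K) ≡ (n + q * σ * m * K) * P
  lem = solve-∀
  lem₂ : ∀ q P s K → q * (P * s) * K * P ≡ s * (q * P * K * P)
  lem₂ = solve-∀

two-cut-excess : ∀ {k} → 2 ≤ k → (H : Hypergraph (suc k) n) → NoIsolatedVertices H →
  ∃[ f ] (matchingBound (suc k) n ≤ℚ excess {suc k} {n} {2} H f)
two-cut-excess {n} {k@(suc k′)} k≥2 H covered =
  let f , cut≥ = large-cut (s≤s z≤n) (s≤s z≤n) H covered
      m = numEdges H
      s = cutSize H f
  in f , ≤-excess n (suc k * 2 ^ k) σ (2 ^ suc k) m s {{m*n≢0 (suc k) (2 ^ k) {{_}} {{m^n≢0 2 k}}}} {{m^n≢0 2 (suc k)}} (begin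
    n * (2 * P) + σ * m * (suc k * P)                ≡⟨ lem n P σ m (suc k) ⟩
    P * (2 * 1 * n + 1 * σ * m * suc k)
      ≡⟨ cong₂ (λ t K → P * (2 * t * n + 1 * σ * m * K)) (sym (surjections-1 k′)) (sym K≡) ⟩
    P * (2 * surjections k 1 * n + 1 * σ * m * (suc k ⊔ 3)) ≤⟨ *-monoʳ-≤ P cut≥ ⟩
    P * (1 * (2 * P * s) * (suc k ⊔ 3))              ≡⟨ cong (λ K → P * (1 * (2 * P * s) * K)) K≡ ⟩
    P * (1 * (2 * P * s) * suc k)                    ≡⟨ lem₂ P s (suc k) ⟩
    s * (suc k * P * (2 * P))                        ∎)
  where
  open ≤-Reasoning
  P = 2 ^ k
  σ = surjections (suc k) 2
  K≡ : suc k ⊔ 3 ≡ suc k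
  -- Uniformity at least 3 makes the maximum with 3 equal to the uniformity itself, which yields the
  -- sharp constant.
  K≡ = m≥n⇒m⊔n≡m (s≤s k≥2)
  lem : ∀ n P σ m k → n * (2 * P) + σ * m * (k * P) ≡ P * (2 * 1 * n + 1 * σ * m * k)
  lem = solve-∀
  lem₂ : ∀ P s k → P * (1 * (2 * P * s) * k) ≡ s * (k * P * (2 * P))
  lem₂ = solve-∀

-- At best all edges are cut, which gives the excess `2 * m / 2 ^ suc k` by `surjections-2`; a
-- perfect matching has `m = n / suc k` edges.
matching-excess-≤ : ∀ {k} (H : Hypergraph (suc k) n) → IsPerfectMatching H → (f : Cut n 2) →
  excess H f ≤ℚ matchingBound (suc k) n
matching-excess-≤ {n} {k} H matching f =
  excess-≤ n (suc k * 2 ^ k) σ (2 ^ suc k) m (cutSize H f) {{m*n≢0 (suc k) (2 ^ k) {{_}} {{m^n≢0 2 k}}}} {{m^n≢0 2 (suc k)}} (begin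
    cutSize H f * (suc k * P * 2 ^ suc k)            ≤⟨ *-monoˡ-≤ (suc k * P * 2 ^ suc k) (length-filter (isCutEdge? f) (edges H)) ⟩
    m * (suc k * P * 2 ^ suc k)                      ≡⟨ cong (λ z → m * (suc k * P * z)) (surjections-2 k) ⟨
    m * (suc k * P * (σ + 2))                        ≡⟨ lem m (suc k) P σ ⟩
    m * suc k * (2 * P) + σ * m * (suc k * P)        ≡⟨ cong (λ z → z * (2 * P) + σ * m * (suc k * P)) (matching-order {H = H} matching) ⟨
    n * (2 * P) + σ * m * (suc k * P)                ∎)
  where
  open ≤-Reasoning
  P = 2 ^ k
  σ = surjections (suc k) 2
  m = numEdges H
  lem : ∀ m k P σ → m * (k * P * (σ + 2)) ≡ m * k * (2 * P) + σ * m * (k * P)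
  lem = solve-∀

theorem1p4 : ((r k : ℕ) → 2 ≤ r → r ≤ k →
    ∃[ c ] (0ℚ <ℚ c ×
    ((n : ℕ) (H : Hypergraph k n) → NoIsolatedVertices H →
    ∃[ f ] (c *ℚ ℕ→ℚ n ≤ℚ excess {k} {n} {r} H f))))
    ×
    ((k : ℕ) → 2 < k →
    ((n : ℕ) (H : Hypergraph k n) → NoIsolatedVertices H →
    ∃[ f ] (matchingBound k n ≤ℚ excess {k} {n} {2} H f))
    ×
    ((n : ℕ) (H : Hypergraph k n) → IsPerfectMatching H →
    (∃[ f ] (excess {k} {n} {2} H f ≡ matchingBound k n))
    × ((f : Cut n 2) → excess H f ≤ℚ matchingBound k n)))
theorem1p4 =
  (λ { (suc q) (suc k) (s≤s q≥1) (s≤s q≤k) → linear-excess q≥1 q≤k }) ,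
  (λ { (suc k) (s≤s k≥2) →
    (λ n H → two-cut-excess k≥2 H) ,
    -- A perfect matching has no isolated vertices, so the general lower bound supplies a cut that
    -- meets the upper bound.
    (λ n H matching → let f , ≤excess = two-cut-excess k≥2 H (matching-covers {H = H} matching) in
      (f , ℚ.≤-antisym (matching-excess-≤ H matching f) ≤excess) , matching-excess-≤ H matching) })
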